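{- For all integers $n\ge 5$, $$\left\lfloor\frac n2\right\rfloor\le \mathrm{ID}_2(n)\le n-3.$$
   Context: Let $X$ be a finite set with $|X|\ge 3$. A split of $X$ is an unordered bipartition $A|B=B|A$ of $X$ into two non-empty disjoint subsets (its parts) with $A\cup B=X$. Its size is $\min\{|A|,|B|\}$; a split of size 1 is called trivial. A split system on $X$ is a set $\mathcal S$ of splits of $X$ that contains all trivial splits $\{x\}|X-\{x\}$, $x\in X$. For $S\in\mathcal S$ and $x\in X$, $S(x)$ denotes the part of $S$ containing $x$. The Buneman graph $\mathcal B(\mathcal S)$ has as vertices all maps $\phi:\mathcal S\to\mathcal P(X)$ such that (B1) $\phi(S)\in S$ for all $S\in\mathcal S$, and (B2) $\phi(S)\cap\phi(S')\ne\emptyset$ for all distinct $S,S'\in\mathcal S$. Two vertices $\phi,\phi'$ are adjacent if there is a unique $S\in\mathcal S$ with $\phi(S)\neq\phi'(S)$. For $x\in X$, $\phi_x$ denotes the vertex $S\mapsto S(x)$. It is known that $\mathcal B(\mathcal S)$ is a median graph, i.e. it is connected and any three vertices $u,v,w$ have a unique median (a vertex lying on shortest paths between each pair of $u,v,w$). For $Y=\{x,y,z\}\in\binom X3$, $\phi_Y$ denotes the median of $\phi_x,\phi_y,\phi_z$ in $\mathcal B(\mathcal S)$. The split system $\mathcal S$ is injective if $\phi_Y\ne\phi_{Y'}$ for all distinct $Y,Y'\in\binom X3$. Two distinct splits $A|B$ and $C|D$ of $X$ are incompatible if $A\cap C$, $A\cap D$, $B\cap C$, $B\cap D$ are all non-empty.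 A set of splits is incompatible if any two distinct splits in it are incompatible. The dimension $\dim(\mathcal S)$ is the dimension of the largest hypercube contained in $\mathcal B(\mathcal S)$ (and 1 if $\mathcal B(\mathcal S)$ is a tree); equivalently (known), it is the maximum size of an incompatible subset of $\mathcal S$. For $n\ge 3$, let $\mathbb S_2(n)$ be the set of all injective split systems on $\{1,\dots,n\}$ all of whose non-trivial splits have size 2, and let $\mathrm{ID}_2(n)=\min\{\dim(\mathcal S):\mathcal S\in\mathbb S_2(n)\}$. -}

module Defs where

open import Data.Bool using (Bool; if_then_else_)
open import Data.Fin using (Fin)
open import Data.Fin.Subset using (Subset; _∈_; _∩_; _∪_; ∁; ⁅_⁆; ∣_∣; Nonempty)
open import Data.Fin.Subset.Properties using (_∈?_; x∈p∩q⁺; x∉p⇒x∈∁p)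
open import Data.Nat using (ℕ; zero; suc; _+_; _≤_; _⊓_)
open import Data.Product using (_×_; ∃!; ∃-syntax; Σ-syntax; _,_)
open import Data.Sum using (_⊎_; inj₁; inj₂)
open import Data.Vec using (Vec; lookup)
open import Function.Definitions using (Injective; Congruent)
open import Level using (0ℓ)
open import Relation.Binary using (Rel; Setoid)
open import Relation.Binary.PropositionalEquality
  using (_≡_; _≢_; refl; sym; trans; setoid)
open import Relation.Nullary using (¬_; does; yes; no)

IsMin : (ℕ → Set) → ℕ → Set
IsMin P m = P m × (∀ k → P k → m ≤ k)

IsMax : (ℕ → Set) → ℕ → Set
IsMax P m = P m × (∀ k → P k → k ≤ m)

-- Vertices form a setoid because the vertices of the Buneman graph are
-- functions, compared pointwise.
record Graph : Set₁ where
  field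
    vertices : Setoid 0ℓ 0ℓ
  open Setoid vertices public renaming (Carrier to Vertex) using (_≈_)
  field
    _~_ : Rel Vertex 0ℓ

module _ (G : Graph) where
  open Graph G

  data Walk : Vertex → Vertex → ℕ → Set where
    nil  : ∀ {u v} → u ≈ v → Walk u v zero
    cons : ∀ {u v w k} → u ~ w → Walk w v k → Walk u v (suc k)

  -- Some walk from u through m to v is no longer than any walk from u to v.
  OnShortestPath : Vertex → Vertex → Vertex → Set
  OnShortestPath u v m =
    ∃[ d ] ∃[ e ] Walk u m d × Walk m v e × (∀ k → Walk u v k → d + e ≤ k)

  IsMedian : Vertex → Vertex → Vertex → Vertex → Set
  IsMedian u v w m =
    OnShortestPath u v m × OnShortestPath v w m × OnShortestPath u w m

hypercube : ℕ → Graph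
hypercube k = record
  { vertices = setoid (Vec Bool k)
  ; _~_      = λ u v → ∃! _≡_ λ i → lookup u i ≢ lookup v i
  }

-- H is isomorphic to a (not necessarily induced) subgraph of G.
Contains : Graph → Graph → Set
Contains G H =
  Σ[ f ∈ (H.Vertex → G.Vertex) ]
    Congruent H._≈_ G._≈_ f × Injective H._≈_ G._≈_ f ×
    (∀ {u v} → u H.~ v → f u G.~ f v)
  where
  module G = Graph G
  module H = Graph H

-- The bipartition A|∁A.  Swapping A and ∁A gives the same split, so splits
-- are compared with _≈ˢ_ and not with _≡_.
record Split (n : ℕ) : Set where
  field
    A    : Subset n
    A≢∅  : Nonempty A
    ∁A≢∅ : Nonempty (∁ A)

_isPartOf_ : ∀ {n} → Subset n → Split n → Set
P isPartOf S = P ≡ A ⊎ P ≡ ∁ A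
  where open Split S

_≈ˢ_ : ∀ {n} → Split n → Split n → Set
S ≈ˢ T = Split.A S isPartOf T

size : ∀ {n} → Split n → ℕ
size S = ∣ A ∣ ⊓ ∣ ∁ A ∣
  where open Split S

Trivial : ∀ {n} → Split n → Set
Trivial S = size S ≡ 1

-- S(x), the part of S containing x.
part : ∀ {n} → Split n → Fin n → Subset n
part S x = if does (x ∈? A) then A else ∁ A
  where open Split S

part-isPartOf : ∀ {n} (S : Split n) x → part S x isPartOf S
part-isPartOf S x with x ∈? Split.A S
... | yes _ = inj₁ refl
... | no  _ = inj₂ refl

x∈part : ∀ {n} (S : Split n) x → x ∈ part S x
x∈part S x with x ∈? Split.A S
... | yes x∈A = x∈A
... | no  x∉A = x∉p⇒x∈∁p x∉A

-- A finite set of splits, given by an enumeration without repetition;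
-- `split i` having ⁅ x ⁆ as a part means that it is the split {x}|X-{x}.
record SplitSystem (n : ℕ) : Set where
  field
    card     : ℕ
    split    : Fin card → Split n
    distinct : Injective _≡_ _≈ˢ_ split
    trivials : ∀ x → ∃[ i ] ⁅ x ⁆ isPartOf split i

module _ {n : ℕ} (𝒮 : SplitSystem n) where
  open SplitSystem 𝒮

  -- A map on 𝒮 is a map on the indices of its enumeration.
  record BunemanVertex : Set where
    field
      φ  : Fin card → Subset n
      B1 : ∀ i → φ i isPartOf split i
      B2 : ∀ i j → i ≢ j → Nonempty (φ i ∩ φ j)

  open BunemanVertex

  buneman : Graph
  buneman = record
    { vertices = record
      { Carrier       = BunemanVertex
      ; _≈_           = λ u v → ∀ i → φ u i ≡ φ v i
      ; isEquivalence = record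
        { refl  = λ _ → refl
        ; sym   = λ p i → sym (p i)
        ; trans = λ p q i → trans (p i) (q i)
        }
      }
    ; _~_ = λ u v → ∃! _≡_ λ i → φ u i ≢ φ v i
    }

  open Graph buneman using (_≈_)

  φₓ : Fin n → BunemanVertex
  φₓ x = record
    { φ  = λ i → part (split i) x
    ; B1 = λ i → part-isPartOf (split i) x
    ; B2 = λ i j _ →
        x , x∈p∩q⁺ (x∈part (split i) x , x∈part (split j) x)
    }

  -- v is φ_Y.  This is stated as a relation; a median graph has exactly one
  -- such v for each 3-element set Y.
  IsφY : Subset n → BunemanVertex → Set
  IsφY Y v =
    ∃[ x ] ∃[ y ] ∃[ z ] Y ≡ ⁅ x ⁆ ∪ ⁅ y ⁆ ∪ ⁅ z ⁆ ×
      IsMedian buneman (φₓ x) (φₓ y) (φₓ z) v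

  InjectiveSystem : Set
  InjectiveSystem =
    ∀ {Y Y′} → ∣ Y ∣ ≡ 3 → ∣ Y′ ∣ ≡ 3 → Y ≢ Y′ →
    ∀ {v v′} → IsφY Y v → IsφY Y′ v′ → ¬ v ≈ v′

  -- The convention that the dimension is 1 when the Buneman graph is a tree
  -- needs no separate clause: for n ≥ 3 there is a trivial split, so the
  -- graph has an edge (a 1-cube), and a tree contains no 4-cycle (2-cube).
  IsDim : ℕ → Set
  IsDim = IsMax (λ k → Contains buneman (hypercube k))

  In𝕊₂ : Set
  In𝕊₂ = InjectiveSystem × (∀ i → ¬ Trivial (split i) → size (split i) ≡ 2)

-- m = ID₂(n); X = {1,…,n} is modelled by Fin n.
IsID₂ : ℕ → ℕ → Set
IsID₂ n = IsMin (λ d → Σ[ 𝒮 ∈ SplitSystem n ] In𝕊₂ 𝒮 × IsDim 𝒮 d)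

{-# OPTIONS --safe #-}
module Submission where

open import Defs
open import Data.Bool using (Bool; true; false; if_then_else_)
import Data.Bool.Properties as Bool
open import Data.Empty using (⊥-elim)
open import Data.Fin
  using (Fin; zero; suc; toℕ; fromℕ<; inject≤; combine; remQuot; finToFun; funToFin; #_; _≟_)
open import Data.Fin.Patterns using (0F; 1F; 2F; 3F)
open import Data.Fin.Properties
  using ( any?; all?; ¬∀⟶∃¬; inject≤-injective; injective⇒≤; suc-injective; toℕ-injective; toℕ<n
        ; toℕ-fromℕ<; remQuot-combine; finToFun-funToFin)
open import Data.Fin.Subset
  using (Subset; _∈_; _∉_; _⊆_; _∩_; _∪_; _-_; ∁; ⊤; ⁅_⁆; ∣_∣; Nonempty; inside; outside)
open import Data.Fin.Subset.Properties
open import Data.List as List using (List; length; filter; allFin; cartesianProduct; deduplicate)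
open import Data.List.Membership.Propositional using (lose) renaming (_∈_ to _∈ˡ_)
open import Data.List.Membership.Propositional.Properties
  using ( ∈-allFin; ∈-cartesianProduct⁺; ∈-deduplicate⁻; ∈-filter⁺; ∈-filter⁻; ∈-lookup
        ; ∈-map⁺; ∈-map⁻)
open import Data.List.Relation.Unary.All as All using ()
open import Data.List.Relation.Unary.AllPairs using (AllPairs; _∷_)
open import Data.List.Relation.Unary.Any as Any using (Any)
import Data.List.Relation.Unary.Any.Properties as Any
open import Data.List.Relation.Unary.Unique.DecSetoid.Properties using (deduplicate-!)
open import Data.Nat
  using (ℕ; zero; suc; _+_; _*_; _∸_; _^_; _⊓_; _%_; _≤_; _<_; z≤n; s≤s; ⌊_/2⌋; ⌈_/2⌉)
  renaming (_≟_ to _≟ℕ_)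
open import Data.Nat.DivMod using (m%n<n; m%n%n≡m%n; %-distribˡ-+; [m+n]%n≡m%n; m<n⇒m%n≡m)
open import Data.Nat.Induction using (Acc; acc; <-wellFounded)
open import Data.Nat.Properties hiding (suc-injective; _≟_)
open import Data.Product
  using (_×_; _,_; proj₁; proj₂; ∃; ∃₂; ∃-syntax; Σ-syntax; uncurry)
open import Data.Sum as Sum using (_⊎_; inj₁; inj₂; [_,_]′)
open import Data.Vec
  using (Vec; []; _∷_; here; there; lookup; replicate; tabulate; _[_]≔_)
open import Data.Vec.Properties
  using ( ≡-dec; lookup⇒[]=; []=⇒lookup; lookup∘tabulate; tabulate∘lookup; tabulate-cong
        ; lookup-replicate; lookup∘updateAt; lookup∘updateAt′; []≔-commutes)
open import Function using (_∘_; id; case_of_)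
open import Function.Definitions using (Injective)
open import Level using (0ℓ)
open import Relation.Binary using (Rel; DecSetoid; Symmetric)
open import Relation.Binary.PropositionalEquality
open import Relation.Nullary
open import Relation.Nullary.Decidable
  using (dec-true; dec-false; decidable-stable; from-yes; map′)

-- A median φ_Y selects the part of each split holding two elements of Y, so a
-- system is injective iff for all Y ≠ Y′ some split has a part holding two
-- elements of Y whose complement holds two elements of Y′.  Cubes in the
-- Buneman graph correspond to incompatible families of splits.  Both criteria
-- depend only on the set of parts and are decidable; a system whose non-trivial
-- splits have size 2 is a graph on X, so ID₂(n) is found by a finite search.
--
-- Lower bound: edges at a common vertex are incompatible, so all degrees are at
-- most the dimension m.  If 2m + 2 ≤ n, some c ≠ d are adjacent to neither end of
-- an edge ab, and the triples abc, abd are not separated.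
--
-- Upper bound: take the complement of the n-cycle.  It separates triples since
-- the cycle contains no 3-cycle or 4-cycle.  Pairwise intersecting edges form a
-- star, of size at most n ∸ 3, or a triangle, and for n = 5 there is no triangle.

private

  -- The definitions speak of walks and of embedded cubes, while the two criteria speak of splits.
  -- The link for medians is the distance formula: two vertices are as far apart as the number of
  -- splits on which they differ, so a vertex lies on a shortest path iff it agrees with both ends
  -- wherever these agree.
  --
  -- `IsID₂` also asserts that the minimum is attained, and an inhabited set of naturals yields a
  -- least element constructively only if membership can be decided. A `SplitSystem` carries an
  -- order and a chosen part of each split, so the search runs over codes, and a system is replaced
  -- by a decoded one that has the same parts but not the same enumeration.
  --
  -- The cycle balances two demands. Two triples that no edge separates produce a 3-cycle or a
  -- 4-cycle among the non-edges, so the non-edges must be sparse. Yet every point needs two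
  -- non-neighbours: together with the point itself they are the 3 in n ∸ 3.

  variable
    n k : ℕ
    a b c d w x y z : Fin n
    p q P Q R Y Y′ : Subset n
    S T : Split n

-- Finite subsets

∁-involutive : ∀ (p : Subset n) → ∁ (∁ p) ≡ p
∁-involutive []      = refl
∁-involutive (s ∷ p) = cong₂ _∷_ (Bool.not-involutive s) (∁-involutive p)

∣p∪q∣≤∣p∣+∣q∣ : ∀ (p q : Subset n) → ∣ p ∪ q ∣ ≤ ∣ p ∣ + ∣ q ∣
∣p∪q∣≤∣p∣+∣q∣ []            []            = z≤n
∣p∪q∣≤∣p∣+∣q∣ (outside ∷ p) (outside ∷ q) = ∣p∪q∣≤∣p∣+∣q∣ p q
∣p∪q∣≤∣p∣+∣q∣ (outside ∷ p) (inside ∷ q)  =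
  ≤-trans (s≤s (∣p∪q∣≤∣p∣+∣q∣ p q)) (≤-reflexive (sym (+-suc ∣ p ∣ ∣ q ∣)))
∣p∪q∣≤∣p∣+∣q∣ (inside ∷ p)  (outside ∷ q) = s≤s (∣p∪q∣≤∣p∣+∣q∣ p q)
∣p∪q∣≤∣p∣+∣q∣ (inside ∷ p)  (inside ∷ q)  =
  s≤s (≤-trans (∣p∪q∣≤∣p∣+∣q∣ p q) (+-monoʳ-≤ ∣ p ∣ (n≤1+n ∣ q ∣)))

disjoint⇒∣p∣+∣q∣≤∣p∪q∣ : ∀ (p q : Subset n) → (∀ {x} → x ∈ p → x ∉ q) →
                         ∣ p ∣ + ∣ q ∣ ≤ ∣ p ∪ q ∣
disjoint⇒∣p∣+∣q∣≤∣p∪q∣ []            []            d = z≤n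
disjoint⇒∣p∣+∣q∣≤∣p∪q∣ (outside ∷ p) (outside ∷ q) d =
  disjoint⇒∣p∣+∣q∣≤∣p∪q∣ p q λ i j → d (there i) (there j)
disjoint⇒∣p∣+∣q∣≤∣p∪q∣ (outside ∷ p) (inside ∷ q)  d =
  ≤-trans (≤-reflexive (+-suc ∣ p ∣ ∣ q ∣))
    (s≤s (disjoint⇒∣p∣+∣q∣≤∣p∪q∣ p q λ i j → d (there i) (there j)))
disjoint⇒∣p∣+∣q∣≤∣p∪q∣ (inside ∷ p)  (outside ∷ q) d =
  s≤s (disjoint⇒∣p∣+∣q∣≤∣p∪q∣ p q λ i j → d (there i) (there j))
disjoint⇒∣p∣+∣q∣≤∣p∪q∣ (inside ∷ p)  (inside ∷ q)  d = ⊥-elim (d here here)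

enumerate : ∀ (p : Subset n) → Fin ∣ p ∣ → Fin n
enumerate (inside ∷ p)  zero    = zero
enumerate (inside ∷ p)  (suc i) = suc (enumerate p i)
enumerate (outside ∷ p) i       = suc (enumerate p i)

enumerate-∈ : ∀ (p : Subset n) i → enumerate p i ∈ p
enumerate-∈ (inside ∷ p)  zero    = here
enumerate-∈ (inside ∷ p)  (suc i) = there (enumerate-∈ p i)
enumerate-∈ (outside ∷ p) i       = there (enumerate-∈ p i)

enumerate-injective : ∀ (p : Subset n) → Injective _≡_ _≡_ (enumerate p)
enumerate-injective (inside ∷ p)  {zero}  {zero}  eq = refl
enumerate-injective (inside ∷ p)  {suc i} {suc j} eq =
  cong suc (enumerate-injective p (suc-injective eq))
enumerate-injective (outside ∷ p) eq = enumerate-injective p (suc-injective eq)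

injective⇒≤∣p∣ : ∀ (f : Fin k → Fin n) → Injective _≡_ _≡_ f →
                 (∀ i → f i ∈ p) → k ≤ ∣ p ∣
injective⇒≤∣p∣ {zero}      f inj f∈p = z≤n
injective⇒≤∣p∣ {suc k} {p = p} f inj f∈p = ≤-<-trans
  (injective⇒≤∣p∣ {p = p - f zero} (f ∘ suc) (suc-injective ∘ inj)
    λ i → x∈p∧x≢y⇒x∈p-y (f∈p (suc i)) λ eq → case inj eq of λ ())
  (x∈p⇒∣p-x∣<∣p∣ (f∈p zero))

elements : ∀ (p : Subset n) → k ≤ ∣ p ∣ →
           ∃[ f ] Injective {A = Fin k} _≡_ _≡_ f × (∀ i → f i ∈ p)
elements p k≤∣p∣ = enumerate p ∘ (λ i → inject≤ i k≤∣p∣)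
                 , inject≤-injective _ _ _ _ ∘ enumerate-injective p
                 , λ i → enumerate-∈ p _

two-elements : ∀ (p : Subset n) → 2 ≤ ∣ p ∣ → ∃₂ λ x y → x ≢ y × x ∈ p × y ∈ p
two-elements p 2≤∣p∣ =
  let f , inj , f∈p = elements p 2≤∣p∣
  in f (# 0) , f (# 1) , (λ eq → case inj eq of λ ()) , f∈p (# 0) , f∈p (# 1)

three-elements : ∀ (p : Subset n) → 3 ≤ ∣ p ∣ →
  ∃[ x ] ∃[ y ] ∃[ z ] (x ≢ y × x ≢ z × y ≢ z) × (x ∈ p × y ∈ p × z ∈ p)
three-elements p 3≤∣p∣ =
  let f , inj , f∈p = elements p 3≤∣p∣
  in f (# 0) , f (# 1) , f (# 2)
   , ( (λ eq → case inj eq of λ ()) , (λ eq → case inj eq of λ ())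
     , (λ eq → case inj eq of λ ()))
   , (f∈p (# 0) , f∈p (# 1) , f∈p (# 2))

three-elements⇒3≤∣p∣ : x ≢ y → x ≢ z → y ≢ z → x ∈ p → y ∈ p → z ∈ p → 3 ≤ ∣ p ∣
three-elements⇒3≤∣p∣ {x = x} {y} {z} x≢y x≢z y≢z x∈p y∈p z∈p =
  ≤-<-trans (≤-<-trans (≤-<-trans z≤n (x∈p⇒∣p-x∣<∣p∣ z∈)) (x∈p⇒∣p-x∣<∣p∣ y∈))
    (x∈p⇒∣p-x∣<∣p∣ x∈p)
  where
  y∈ = x∈p∧x≢y⇒x∈p-y y∈p (x≢y ∘ sym)
  z∈ = x∈p∧x≢y⇒x∈p-y (x∈p∧x≢y⇒x∈p-y z∈p (x≢z ∘ sym)) (y≢z ∘ sym)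

p⊆q∧∣q∣≤∣p∣⇒p≡q : ∀ (p q : Subset n) → p ⊆ q → ∣ q ∣ ≤ ∣ p ∣ → p ≡ q
p⊆q∧∣q∣≤∣p∣⇒p≡q p q p⊆q ∣q∣≤∣p∣ = ⊆-antisym p⊆q q⊆p
  where
  q⊆p : q ⊆ p
  q⊆p {x} x∈q with x ∈? p
  ... | yes x∈p = x∈p
  ... | no x∉p  = ⊥-elim (<⇒≱ (p⊂q⇒∣p∣<∣q∣ (p⊆q , x , x∈q , x∉p)) ∣q∣≤∣p∣)

∣p∣<n⇒∁p≢∅ : ∀ (p : Subset n) → ∣ p ∣ < n → Nonempty (∁ p)
∣p∣<n⇒∁p≢∅ {n} p ∣p∣<n with nonempty? (∁ p)
... | yes ne = ne
... | no ∄x  = ⊥-elim (<⇒≱ ∣p∣<n (≤-trans (≤-reflexive (sym (∣⊤∣≡n n)))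
                 (p⊆q⇒∣p∣≤∣q∣ {p = ⊤} λ {x} _ → x∉∁p⇒x∈p λ x∈ → ∄x (x , x∈))))

-- Also covers singletons, as pair x x.
pair : Fin n → Fin n → Subset n
pair x y = ⁅ x ⁆ ∪ ⁅ y ⁆

∈-pair⁻ : ∀ (x y : Fin n) → z ∈ pair x y → z ≡ x ⊎ z ≡ y
∈-pair⁻ x y = Sum.map (x∈⁅y⁆⇒x≡y x) (x∈⁅y⁆⇒x≡y y) ∘ x∈p∪q⁻ ⁅ x ⁆ ⁅ y ⁆

∈-pairˡ : ∀ (x y : Fin n) → x ∈ pair x y
∈-pairˡ x y = x∈p∪q⁺ (inj₁ (x∈⁅x⁆ x))

∈-pairʳ : ∀ (x y : Fin n) → y ∈ pair x y
∈-pairʳ x y = x∈p∪q⁺ (inj₂ (x∈⁅x⁆ y))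

∉-pair : ∀ (x y : Fin n) → z ≢ x → z ≢ y → z ∈ ∁ (pair x y)
∉-pair x y z≢x z≢y = x∉p⇒x∈∁p ([ z≢x , z≢y ]′ ∘ ∈-pair⁻ x y)

pair⊆ : x ∈ p → y ∈ p → pair x y ⊆ p
pair⊆ {x = x} {y = y} x∈p y∈p = [ (λ { refl → x∈p }) , (λ { refl → y∈p }) ]′ ∘ ∈-pair⁻ x y

∣pair∣≤2 : ∀ (x y : Fin n) → ∣ pair x y ∣ ≤ 2
∣pair∣≤2 x y = ≤-trans (∣p∪q∣≤∣p∣+∣q∣ ⁅ x ⁆ ⁅ y ⁆)
  (≤-reflexive (cong₂ _+_ (∣⁅x⁆∣≡1 x) (∣⁅x⁆∣≡1 y)))

∣p∣≤2⇒pair : x ≢ y → x ∈ p → y ∈ p → ∣ p ∣ ≤ 2 → p ≡ pair x y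
∣p∣≤2⇒pair {x = x} {y} {p} x≢y x∈p y∈p ∣p∣≤2 = ⊆-antisym p⊆ (pair⊆ x∈p y∈p)
  where
  p⊆ : p ⊆ pair x y
  p⊆ {z} z∈p with z ≟ x | z ≟ y
  ... | yes refl | _        = ∈-pairˡ x y
  ... | no _     | yes refl = ∈-pairʳ x y
  ... | no z≢x   | no z≢y   = ⊥-elim (<⇒≱
    (three-elements⇒3≤∣p∣ x≢y (z≢x ∘ sym) (z≢y ∘ sym) x∈p y∈p z∈p) ∣p∣≤2)

Nonempty∧∣p∣≤2⇒pair : Nonempty p → ∣ p ∣ ≤ 2 → ∃₂ λ x y → p ≡ pair x y
Nonempty∧∣p∣≤2⇒pair {p = p} (x , x∈p) ∣p∣≤2
  with any? (λ y → ¬? (x ≟ y) ×-dec (y ∈? p))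
... | yes (y , x≢y , y∈p) = x , y , ∣p∣≤2⇒pair x≢y x∈p y∈p ∣p∣≤2
... | no ∄y = x , x , ⊆-antisym p⊆ (pair⊆ x∈p x∈p)
  where
  p⊆ : p ⊆ pair x x
  p⊆ {z} z∈p with x ≟ z
  ... | yes refl = ∈-pairˡ x x
  ... | no x≢z   = ⊥-elim (∄y (z , x≢z , z∈p))

triple : Fin n → Fin n → Fin n → Subset n
triple x y z = ⁅ x ⁆ ∪ pair y z

∈-triple⁻ : ∀ (x y z : Fin n) → w ∈ triple x y z → w ≡ x ⊎ w ≡ y ⊎ w ≡ z
∈-triple⁻ x y z = Sum.map (x∈⁅y⁆⇒x≡y x) (∈-pair⁻ y z) ∘ x∈p∪q⁻ ⁅ x ⁆ (pair y z)

∈-triple₁ : ∀ (x y z : Fin n) → x ∈ triple x y z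
∈-triple₁ x y z = x∈p∪q⁺ (inj₁ (x∈⁅x⁆ x))

∈-triple₂ : ∀ (x y z : Fin n) → y ∈ triple x y z
∈-triple₂ x y z = x∈p∪q⁺ (inj₂ (∈-pairˡ y z))

∈-triple₃ : ∀ (x y z : Fin n) → z ∈ triple x y z
∈-triple₃ x y z = x∈p∪q⁺ (inj₂ (∈-pairʳ y z))

∣triple∣≤3 : ∀ (x y z : Fin n) → ∣ triple x y z ∣ ≤ 3
∣triple∣≤3 x y z = ≤-trans (∣p∪q∣≤∣p∣+∣q∣ ⁅ x ⁆ (pair y z))
  (+-mono-≤ (≤-reflexive (∣⁅x⁆∣≡1 x)) (∣pair∣≤2 y z))

∣triple∣≡3 : x ≢ y → x ≢ z → y ≢ z → ∣ triple x y z ∣ ≡ 3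
∣triple∣≡3 {x = x} {y} {z} x≢y x≢z y≢z = ≤-antisym (∣triple∣≤3 x y z)
  (three-elements⇒3≤∣p∣ x≢y x≢z y≢z (∈-triple₁ x y z) (∈-triple₂ x y z) (∈-triple₃ x y z))

∣p∣≡3⇒triple : ∣ p ∣ ≡ 3 → ∃[ x ] ∃[ y ] ∃[ z ] (x ≢ y × x ≢ z × y ≢ z) × p ≡ triple x y z
∣p∣≡3⇒triple {p = p} ∣p∣≡3 with three-elements p (≤-reflexive (sym ∣p∣≡3))
... | x , y , z , ≢s@(x≢y , x≢z , y≢z) , x∈p , y∈p , z∈p = x , y , z , ≢s
    , sym (p⊆q∧∣q∣≤∣p∣⇒p≡q (triple x y z) p
        ([ (λ { refl → x∈p }) , [ (λ { refl → y∈p }) , (λ { refl → z∈p }) ]′ ]′ ∘ ∈-triple⁻ x y z)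
        (≤-reflexive (trans ∣p∣≡3 (sym (∣triple∣≡3 x≢y x≢z y≢z)))))

-- Minima and maxima of decidable predicates

IsMin-exists : ∀ {P : ℕ → Set} → (∀ m → Dec (P m)) → ∀ m → P m → ∃ (IsMin P)
IsMin-exists {P} P? m = go m (<-wellFounded m)
  where
  go : ∀ m → Acc _<_ m → P m → ∃ (IsMin P)
  go m (acc rec) Pm with anyUpTo? P? m
  ... | yes (k , k<m , Pk) = go k (rec k<m) Pk
  ... | no ∄k = m , Pm , λ k Pk → ≮⇒≥ λ k<m → ∄k (k , k<m , Pk)

IsMax-exists : ∀ {P : ℕ → Set} → (∀ m → Dec (P m)) → P 0 →
               ∀ b → (∀ k → P k → k ≤ b) → ∃ (IsMax P)
IsMax-exists P? P0 zero    bound = 0 , P0 , bound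
IsMax-exists P? P0 (suc b) bound with P? (suc b)
... | yes Pb = suc b , Pb , bound
... | no ¬Pb = IsMax-exists P? P0 b λ k Pk → m<1+n⇒m≤n
      (≤∧≢⇒< (bound k Pk) λ { refl → ¬Pb Pk })

IsMax-unique : ∀ {P : ℕ → Set} {m m′} → IsMax P m → IsMax P m′ → m ≡ m′
IsMax-unique (Pm , max) (Pm′ , max′) = ≤-antisym (max′ _ Pm) (max _ Pm′)

argmin : ∀ {P : Fin k → Set} → (∀ i → Dec (P i)) → ∀ (μ : Fin k → ℕ) → ∃ P →
         ∃[ i ] P i × (∀ j → P j → μ i ≤ μ j)
argmin {P = P} P? μ (i , Pi)
  with IsMin-exists {λ d → ∃[ j ] P j × μ j ≡ d} (λ d → any? λ j → P? j ×-dec μ j ≟ℕ d)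
         (μ i) (i , Pi , refl)
... | _ , (j , Pj , refl) , min = j , Pj , λ l Pl → min (μ l) (l , Pl , refl)

_≟ˢ_ : (p q : Subset n) → Dec (p ≡ q)
_≟ˢ_ = ≡-dec Bool._≟_

comprehension : {P : Fin n → Set} → (∀ x → Dec (P x)) → Subset n
comprehension P? = tabulate (does ∘ P?)

∈-comprehension⁺ : ∀ {P : Fin n → Set} (P? : ∀ x → Dec (P x)) → P x → x ∈ comprehension P?
∈-comprehension⁺ {x = x} P? Px = lookup⇒[]= x _ (trans (lookup∘tabulate _ x) (dec-true (P? x) Px))

∈-comprehension⁻ : ∀ {P : Fin n → Set} (P? : ∀ x → Dec (P x)) → x ∈ comprehension P? → P x
∈-comprehension⁻ {x = x} P? x∈ with P? x | trans (sym (lookup∘tabulate (does ∘ P?) x)) ([]=⇒lookup x∈)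
... | yes Px | _ = Px

-- Parts of splits

∁-isPartOf : P isPartOf S → ∁ P isPartOf S
∁-isPartOf (inj₁ refl) = inj₂ refl
∁-isPartOf {S = S} (inj₂ refl) = inj₁ (∁-involutive (Split.A S))

isPartOf⇒≡∨≡∁ : ∀ (S : Split n) → P isPartOf S → Q isPartOf S → Q ≡ P ⊎ Q ≡ ∁ P
isPartOf⇒≡∨≡∁ S (inj₁ refl) (inj₁ refl) = inj₁ refl
isPartOf⇒≡∨≡∁ S (inj₁ refl) (inj₂ refl) = inj₂ refl
isPartOf⇒≡∨≡∁ S (inj₂ refl) (inj₁ refl) = inj₂ (sym (∁-involutive _))
isPartOf⇒≡∨≡∁ S (inj₂ refl) (inj₂ refl) = inj₁ refl

part≢∅ : ∀ (S : Split n) → P isPartOf S → Nonempty P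
part≢∅ S (inj₁ refl) = Split.A≢∅ S
part≢∅ S (inj₂ refl) = Split.∁A≢∅ S

P≢∁P : ∀ (S : Split n) → P isPartOf S → P ≢ ∁ P
P≢∁P S P∣ P≡∁P with part≢∅ S P∣
... | x , x∈P = x∈∁p⇒x∉p (subst (x ∈_) P≡∁P x∈P) x∈P

two-parts : ∀ (S : Split n) → P isPartOf S → Q isPartOf S → R isPartOf S →
            P ≢ Q → P ≢ R → Q ≡ R
two-parts S P∣ Q∣ R∣ P≢Q P≢R with isPartOf⇒≡∨≡∁ S P∣ Q∣ | isPartOf⇒≡∨≡∁ S P∣ R∣
... | inj₁ refl | _         = ⊥-elim (P≢Q refl)
... | inj₂ _    | inj₁ refl = ⊥-elim (P≢R refl)
... | inj₂ refl | inj₂ refl = refl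

part≡ : ∀ (S : Split n) → P isPartOf S → x ∈ P → part S x ≡ P
part≡ {P = P} {x} S P∣ x∈P with isPartOf⇒≡∨≡∁ S P∣ (part-isPartOf S x)
... | inj₁ eq = eq
... | inj₂ eq = ⊥-elim (x∈∁p⇒x∉p (subst (x ∈_) eq (x∈part S x)) x∈P)

isPartOf-≈ˢ : ∀ (S T : Split n) → S ≈ˢ T → P isPartOf S → P isPartOf T
isPartOf-≈ˢ S T S≈T (inj₁ refl) = S≈T
isPartOf-≈ˢ S T S≈T (inj₂ refl) = ∁-isPartOf {S = T} S≈T

common-part⇒≈ˢ : ∀ (S T : Split n) → P isPartOf S → P isPartOf T → S ≈ˢ T
common-part⇒≈ˢ S T P∣S P∣T with isPartOf⇒≡∨≡∁ S P∣S (inj₁ refl)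
... | inj₁ eq = subst (_isPartOf T) (sym eq) P∣T
... | inj₂ eq = subst (_isPartOf T) (sym eq) (∁-isPartOf {S = T} P∣T)

-- Incompatibility of two splits

Incompatible : Split n → Split n → Set
Incompatible S T = ∀ P Q → P isPartOf S → Q isPartOf T → Nonempty (P ∩ Q)

-- Failure of incompatibility comes with two disjoint parts as witnesses; the construction of cubes
-- uses these parts themselves.
Incompatible-or-disjoint-parts : ∀ (S T : Split n) → Incompatible S T ⊎
  (∃₂ λ P Q → P isPartOf S × Q isPartOf T × (∀ {x} → x ∈ P → x ∉ Q))
Incompatible-or-disjoint-parts S T
  with nonempty? (A S ∩ A T) | nonempty? (A S ∩ ∁ (A T))
     | nonempty? (∁ (A S) ∩ A T) | nonempty? (∁ (A S) ∩ ∁ (A T))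
  where open Split
... | yes a | yes b | yes c | yes d = inj₁ λ where
        _ _ (inj₁ refl) (inj₁ refl) → a
        _ _ (inj₁ refl) (inj₂ refl) → b
        _ _ (inj₂ refl) (inj₁ refl) → c
        _ _ (inj₂ refl) (inj₂ refl) → d
... | no ¬a | _ | _ | _ = inj₂ (_ , _ , inj₁ refl , inj₁ refl , λ x∈ x∈′ → ¬a (_ , x∈p∩q⁺ (x∈ , x∈′)))
... | yes _ | no ¬b | _ | _ = inj₂ (_ , _ , inj₁ refl , inj₂ refl , λ x∈ x∈′ → ¬b (_ , x∈p∩q⁺ (x∈ , x∈′)))
... | yes _ | yes _ | no ¬c | _ =
      inj₂ (_ , _ , inj₂ refl , inj₁ refl , λ x∈ x∈′ → ¬c (_ , x∈p∩q⁺ (x∈ , x∈′)))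
... | yes _ | yes _ | yes _ | no ¬d =
      inj₂ (_ , _ , inj₂ refl , inj₂ refl , λ x∈ x∈′ → ¬d (_ , x∈p∩q⁺ (x∈ , x∈′)))

Incompatible? : ∀ (S T : Split n) → Dec (Incompatible S T)
Incompatible? S T with Incompatible-or-disjoint-parts S T
... | inj₁ inc = yes inc
... | inj₂ (P , Q , P∣ , Q∣ , disjoint) = no λ inc →
        let _ , x∈ = inc P Q P∣ Q∣ in
        disjoint (proj₁ (x∈p∩q⁻ P Q x∈)) (proj₂ (x∈p∩q⁻ P Q x∈))

Incompatible⇒≉ˢ : ∀ (S T : Split n) → Incompatible S T → ¬ S ≈ˢ T
Incompatible⇒≉ˢ S T inc S≈T
  with inc _ _ (inj₁ refl) (∁-isPartOf {S = T} S≈T)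
... | x , x∈ = let x∈A , x∈∁A = x∈p∩q⁻ (Split.A S) _ x∈ in x∈∁p⇒x∉p x∈∁A x∈A

module _ (𝒮 : SplitSystem n) where
  open SplitSystem 𝒮
  open BunemanVertex
  open Graph (buneman 𝒮) using (_≈_; _~_)

  private
    V : Set
    V = BunemanVertex 𝒮

  -- The graph distance in the Buneman graph

  differ? : ∀ (u v : V) i → Dec (φ u i ≢ φ v i)
  differ? u v i = ¬? (φ u i ≟ˢ φ v i)

  Δ : V → V → Subset card
  Δ u v = comprehension (differ? u v)

  ∈Δ⁺ : ∀ u v {i} → φ u i ≢ φ v i → i ∈ Δ u v
  ∈Δ⁺ u v = ∈-comprehension⁺ (differ? u v)

  ∈Δ⁻ : ∀ u v {i} → i ∈ Δ u v → φ u i ≢ φ v i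
  ∈Δ⁻ u v = ∈-comprehension⁻ (differ? u v)

  -- Each edge changes one split only, so a walk must have an edge for every split in `Δ u v`.
  ∣Δ∣≤length : ∀ {u v k} → Walk (buneman 𝒮) u v k → ∣ Δ u v ∣ ≤ k
  ∣Δ∣≤length {u} {v} (nil u≈v) = ≤-reflexive (trans (cong ∣_∣ (Empty-unique
    λ (i , i∈) → ∈Δ⁻ u v i∈ (u≈v i))) (∣⊥∣≡0 card))
  ∣Δ∣≤length {u} {v} (cons {w = w} {k} (i , _ , unique) walk) = begin
    ∣ Δ u v ∣              ≤⟨ p⊆q⇒∣p∣≤∣q∣ Δ⊆ ⟩
    ∣ ⁅ i ⁆ ∪ Δ w v ∣      ≤⟨ ∣p∪q∣≤∣p∣+∣q∣ ⁅ i ⁆ (Δ w v) ⟩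
    ∣ ⁅ i ⁆ ∣ + ∣ Δ w v ∣  ≡⟨ cong (_+ ∣ Δ w v ∣) (∣⁅x⁆∣≡1 i) ⟩
    suc ∣ Δ w v ∣          ≤⟨ s≤s (∣Δ∣≤length walk) ⟩
    suc k                  ∎
    where
    open ≤-Reasoning
    Δ⊆ : Δ u v ⊆ ⁅ i ⁆ ∪ Δ w v
    Δ⊆ {j} j∈ with φ u j ≟ˢ φ w j
    ... | yes eq = x∈p∪q⁺ (inj₂ (∈Δ⁺ w v λ eq′ → ∈Δ⁻ u v j∈ (trans eq eq′)))
    ... | no neq = x∈p∪q⁺ (inj₁ (subst (_∈ ⁅ i ⁆) (unique neq) (x∈⁅x⁆ i)))

  -- Among the splits on which u and v differ, one whose part in u is minimal
  -- can be switched to its part in v: a split violating (B2) would have a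
  -- smaller part in u, or the part that v chooses would violate (B2) in v.
  module _ (u v : V) (i : Fin card) (i∈Δ : φ u i ≢ φ v i)
           (min : ∀ j → φ u j ≢ φ v j → ∣ φ u i ∣ ≤ ∣ φ u j ∣) where

    private
      switched : Fin card → Subset n
      switched j = if does (j ≟ i) then φ v i else φ u j

      switched-i : switched i ≡ φ v i
      switched-i rewrite dec-true (i ≟ i) refl = refl

      switched-≢ : ∀ {j} → j ≢ i → switched j ≡ φ u j
      switched-≢ {j} j≢i rewrite dec-false (j ≟ i) j≢i = refl

      φvi≡∁ : φ v i ≡ ∁ (φ u i)
      φvi≡∁ with isPartOf⇒≡∨≡∁ (split i) (B1 u i) (B1 v i)
      ... | inj₁ eq = ⊥-elim (i∈Δ (sym eq))
      ... | inj₂ eq = eq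

      meets : ∀ j → j ≢ i → Nonempty (φ v i ∩ φ u j)
      meets j j≢i with φ u j ≟ˢ φ v j
      ... | yes eq = subst (λ P → Nonempty (φ v i ∩ P)) (sym eq) (B2 v i j (j≢i ∘ sym))
      ... | no neq with nonempty? (φ v i ∩ φ u j)
      ...   | yes ne = ne
      -- A missing intersection puts `φ u j` inside the complement of `φ v i`, which is `φ u i`.
      -- Minimality makes the two equal, so the splits share a part and `distinct` identifies j with
      -- i.
      ...   | no ∄x = ⊥-elim (j≢i (distinct (common-part⇒≈ˢ (split j) (split i)
                       (B1 u j) (subst (_isPartOf split i) (sym uj≡ui) (B1 u i)))))
        where
        uj⊆ui : φ u j ⊆ φ u i
        uj⊆ui {x} x∈uj = x∉∁p⇒x∈p λ x∈∁ →
          ∄x (x , x∈p∩q⁺ (subst (x ∈_) (sym φvi≡∁) x∈∁ , x∈uj))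
        ui⊆uj : φ u i ⊆ φ u j
        ui⊆uj {x} x∈ui with x ∈? φ u j
        ... | yes x∈uj = x∈uj
        ... | no x∉uj  = ⊥-elim (<⇒≱ (p⊂q⇒∣p∣<∣q∣ (uj⊆ui , x , x∈ui , x∉uj)) (min j neq))
        uj≡ui : φ u j ≡ φ u i
        uj≡ui = ⊆-antisym uj⊆ui ui⊆uj

    switch : V
    φ switch = switched
    B1 switch j with j ≟ i
    ... | yes refl = B1 v i
    ... | no _     = B1 u j
    B2 switch j l j≢l with j ≟ i | l ≟ i
    ... | yes refl | yes refl = ⊥-elim (j≢l refl)
    ... | yes refl | no l≢i   = meets l l≢i
    ... | no j≢i   | yes refl = subst Nonempty (∩-comm (φ v i) (φ u j)) (meets j j≢i)
    ... | no _     | no _     = B2 u j l j≢l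

    u~switch : u ~ switch
    u~switch = i , (λ eq → i∈Δ (trans eq switched-i)) , unique
      where
      unique : ∀ {j} → φ u j ≢ switched j → i ≡ j
      unique {j} neq with i ≟ j
      ... | yes eq  = eq
      ... | no i≢j  = ⊥-elim (neq (sym (switched-≢ (i≢j ∘ sym))))

    ∣Δ-switch∣< : ∣ Δ switch v ∣ < ∣ Δ u v ∣
    ∣Δ-switch∣< = p⊂q⇒∣p∣<∣q∣ (Δ⊆ , i , ∈Δ⁺ u v i∈Δ , λ i∈ → ∈Δ⁻ switch v i∈ switched-i)
      where
      Δ⊆ : Δ switch v ⊆ Δ u v
      Δ⊆ {j} j∈ with j ≟ i
      ... | yes refl = ∈Δ⁺ u v i∈Δ
      ... | no j≢i   = ∈Δ⁺ u v λ eq → ∈Δ⁻ switch v j∈ (trans (switched-≢ j≢i) eq)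

  -- Repeated switching towards v, each switch removing a split from `Δ`. With `∣Δ∣≤length` this
  -- shows that the distance is `∣ Δ u v ∣`. The bound b in `go` only drives the recursion.
  geodesic : ∀ u v → ∃[ d ] d ≤ ∣ Δ u v ∣ × Walk (buneman 𝒮) u v d
  geodesic u v = go u ∣ Δ u v ∣ ≤-refl
    where
    go : ∀ u b → ∣ Δ u v ∣ ≤ b → ∃[ d ] d ≤ ∣ Δ u v ∣ × Walk (buneman 𝒮) u v d
    go u b ∣Δ∣≤b with any? (differ? u v)
    ... | no ∄i = 0 , z≤n , nil λ i → decidable-stable (φ u i ≟ˢ φ v i) λ neq → ∄i (i , neq)
    ... | yes ∃i with argmin (differ? u v) (λ i → ∣ φ u i ∣) ∃i
    ...   | i , i∈Δ , min with b | ≤-trans (∣Δ-switch∣< u v i i∈Δ min) ∣Δ∣≤b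
    ...     | suc b′ | s≤s ∣Δ∣≤b′ =
      let d , d≤ , walk = go (switch u v i i∈Δ min) b′ ∣Δ∣≤b′ in
      suc d , ≤-trans (s≤s d≤) (∣Δ-switch∣< u v i i∈Δ min) , cons (u~switch u v i i∈Δ min) walk

  -- The interval between u and v, described split by split; the next two lemmas identify it with
  -- `OnShortestPath`.
  Between : V → V → V → Set
  Between u v m = ∀ i → φ u i ≡ φ v i → φ m i ≡ φ u i

  -- A deviation of m at a split i on which u and v agree is switched on the way to m and back
  -- afterwards. Leaving i out of the second half still covers `Δ u v`, so the path through m is too
  -- long.
  OnShortestPath⇒Between : ∀ {u v m} → OnShortestPath (buneman 𝒮) u v m → Between u v m
  OnShortestPath⇒Between {u} {v} {m} (d , e , um , mv , shortest) i ui≡vi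
    with φ m i ≟ˢ φ u i
  ... | yes eq = eq
  ... | no mi≢ui = ⊥-elim (<-irrefl refl (begin-strict
    ∣ Δ u v ∣                  ≤⟨ p⊆q⇒∣p∣≤∣q∣ Δ⊆ ⟩
    ∣ Δ u m ∪ (Δ m v - i) ∣    ≤⟨ ∣p∪q∣≤∣p∣+∣q∣ (Δ u m) (Δ m v - i) ⟩
    ∣ Δ u m ∣ + ∣ Δ m v - i ∣  <⟨ +-monoʳ-< ∣ Δ u m ∣ (x∈p⇒∣p-x∣<∣p∣ i∈) ⟩
    ∣ Δ u m ∣ + ∣ Δ m v ∣      ≤⟨ +-mono-≤ (∣Δ∣≤length um) (∣Δ∣≤length mv) ⟩
    d + e                      ≤⟨ shortest _ walk ⟩
    proj₁ (geodesic u v)       ≤⟨ len≤ ⟩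
    ∣ Δ u v ∣                  ∎))
    where
    open ≤-Reasoning
    len≤ = proj₁ (proj₂ (geodesic u v))
    walk = proj₂ (proj₂ (geodesic u v))
    i∈ : i ∈ Δ m v
    i∈ = ∈Δ⁺ m v λ eq → mi≢ui (trans eq (sym ui≡vi))
    Δ⊆ : Δ u v ⊆ Δ u m ∪ (Δ m v - i)
    Δ⊆ {j} j∈ with φ u j ≟ˢ φ m j
    ... | no neq = x∈p∪q⁺ (inj₁ (∈Δ⁺ u m neq))
    ... | yes eq = x∈p∪q⁺ (inj₂ (x∈p∧x≢y⇒x∈p-y
            (∈Δ⁺ m v λ eq′ → ∈Δ⁻ u v j∈ (trans eq eq′)) λ { refl → ∈Δ⁻ u v j∈ ui≡vi }))

  -- A split has two parts, so where m differs from both u and v these two agree, against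
  -- betweenness. Hence `Δ u m` and `Δ m v` are disjoint subsets of `Δ u v` and the two distances
  -- add up.
  Between⇒OnShortestPath : ∀ {u v m} → Between u v m → OnShortestPath (buneman 𝒮) u v m
  Between⇒OnShortestPath {u} {v} {m} between =
    let d , d≤ , um = geodesic u m
        e , e≤ , mv = geodesic m v
    in d , e , um , mv , λ k walk → begin
      d + e                  ≤⟨ +-mono-≤ d≤ e≤ ⟩
      ∣ Δ u m ∣ + ∣ Δ m v ∣  ≤⟨ disjoint⇒∣p∣+∣q∣≤∣p∪q∣ (Δ u m) (Δ m v) disjoint ⟩
      ∣ Δ u m ∪ Δ m v ∣      ≤⟨ p⊆q⇒∣p∣≤∣q∣ ∪⊆ ⟩
      ∣ Δ u v ∣              ≤⟨ ∣Δ∣≤length walk ⟩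
      k                      ∎
    where
    open ≤-Reasoning
    disjoint : ∀ {i} → i ∈ Δ u m → i ∉ Δ m v
    disjoint {i} i∈um i∈mv = ∈Δ⁻ u m i∈um (sym (between i
      (two-parts (split i) (B1 m i) (B1 u i) (B1 v i) (∈Δ⁻ u m i∈um ∘ sym) (∈Δ⁻ m v i∈mv))))
    ∪⊆ : Δ u m ∪ Δ m v ⊆ Δ u v
    ∪⊆ {i} i∈ = ∈Δ⁺ u v λ eq → [ (λ i∈um → ∈Δ⁻ u m i∈um (sym (between i eq)))
                               , (λ i∈mv → ∈Δ⁻ m v i∈mv (trans (between i eq) eq)) ]′
                               (x∈p∪q⁻ (Δ u m) (Δ m v) i∈)

-- Majority parts and separation of triples

TwoIn : Subset n → Subset n → Set
TwoIn P Y = ∃₂ λ x y → x ≢ y × (x ∈ P × y ∈ P) × (x ∈ Y × y ∈ Y)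

TwoIn? : ∀ (P Y : Subset n) → Dec (TwoIn P Y)
TwoIn? P Y = any? λ x → any? λ y →
  ¬? (x ≟ y) ×-dec (x ∈? P ×-dec y ∈? P) ×-dec (x ∈? Y ×-dec y ∈? Y)

-- Pigeonhole. The disjunction for Q has the shape of `isPartOf`, so for P = `Split.A S` the result
-- is at once a part of S.
two-of-three : ∀ (P : Subset n) x y z →
  ∃[ Q ] (Q ≡ P ⊎ Q ≡ ∁ P) × (x ∈ Q × y ∈ Q ⊎ x ∈ Q × z ∈ Q ⊎ y ∈ Q × z ∈ Q)
two-of-three P x y z with x ∈? P | y ∈? P | z ∈? P
... | yes x∈ | yes y∈ | _      = P , inj₁ refl , inj₁ (x∈ , y∈)
... | yes x∈ | no _   | yes z∈ = P , inj₁ refl , inj₂ (inj₁ (x∈ , z∈))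
... | no _   | yes y∈ | yes z∈ = P , inj₁ refl , inj₂ (inj₂ (y∈ , z∈))
... | no x∉  | no y∉  | _      = ∁ P , inj₂ refl , inj₁ (x∉p⇒x∈∁p x∉ , x∉p⇒x∈∁p y∉)
... | no x∉  | yes _  | no z∉  = ∁ P , inj₂ refl , inj₂ (inj₁ (x∉p⇒x∈∁p x∉ , x∉p⇒x∈∁p z∉))
... | yes _  | no y∉  | no z∉  = ∁ P , inj₂ refl , inj₂ (inj₂ (x∉p⇒x∈∁p y∉ , x∉p⇒x∈∁p z∉))

TwoIn-or-∁ : ∣ Y ∣ ≡ 3 → ∀ P → TwoIn P Y ⊎ TwoIn (∁ P) Y
TwoIn-or-∁ {Y = Y} ∣Y∣≡3 P with three-elements Y (≤-reflexive (sym ∣Y∣≡3))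
... | x , y , z , (x≢y , x≢z , y≢z) , x∈Y , y∈Y , z∈Y with two-of-three P x y z
...   | Q , Q≡ , two = Sum.map (λ eq → subst (λ R → TwoIn R Y) eq (two-in two))
                               (λ eq → subst (λ R → TwoIn R Y) eq (two-in two)) Q≡
  where
  two-in : x ∈ Q × y ∈ Q ⊎ x ∈ Q × z ∈ Q ⊎ y ∈ Q × z ∈ Q → TwoIn Q Y
  two-in (inj₁ x,y∈)        = x , y , x≢y , x,y∈ , (x∈Y , y∈Y)
  two-in (inj₂ (inj₁ x,z∈)) = x , z , x≢z , x,z∈ , (x∈Y , z∈Y)
  two-in (inj₂ (inj₂ y,z∈)) = y , z , y≢z , y,z∈ , (y∈Y , z∈Y)

HasPart : SplitSystem n → Subset n → Set
HasPart 𝒮 P = ∃[ i ] P isPartOf SplitSystem.split 𝒮 i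

HasPart-∁ : ∀ (𝒮 : SplitSystem n) → HasPart 𝒮 P → HasPart 𝒮 (∁ P)
HasPart-∁ 𝒮 (i , P∣) = i , ∁-isPartOf {S = SplitSystem.split 𝒮 i} P∣

Separated : SplitSystem n → Subset n → Subset n → Set
Separated 𝒮 Y Y′ = ∃[ P ] HasPart 𝒮 P × TwoIn P Y × TwoIn (∁ P) Y′

Separated-sym : ∀ (𝒮 : SplitSystem n) → Separated 𝒮 Y Y′ → Separated 𝒮 Y′ Y
Separated-sym {Y = Y} 𝒮 (P , has , two , two′) =
  ∁ P , HasPart-∁ 𝒮 has , two′ , subst (λ Q → TwoIn Q Y) (sym (∁-involutive P)) two

Separated? : ∀ (𝒮 : SplitSystem n) Y Y′ → Dec (Separated 𝒮 Y Y′)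
Separated? 𝒮 Y Y′ = map′ to from (any? λ i →
  (TwoIn? (A (split i)) Y ×-dec TwoIn? (∁ (A (split i))) Y′) ⊎-dec
  (TwoIn? (∁ (A (split i))) Y ×-dec TwoIn? (∁ (∁ (A (split i)))) Y′))
  where
  open SplitSystem 𝒮
  open Split
  to : _ → Separated 𝒮 Y Y′
  to (i , inj₁ (two , two′)) = _ , (i , inj₁ refl) , two , two′
  to (i , inj₂ (two , two′)) = _ , (i , inj₂ refl) , two , two′
  from : Separated 𝒮 Y Y′ → _
  from (_ , (i , inj₁ refl) , two , two′) = i , inj₁ (two , two′)
  from (_ , (i , inj₂ refl) , two , two′) = i , inj₂ (two , two′)

Separating : SplitSystem n → Set
Separating 𝒮 = ∀ Y Y′ → ∣ Y ∣ ≡ 3 → ∣ Y′ ∣ ≡ 3 → Y ≢ Y′ → Separated 𝒮 Y Y′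

Separating? : ∀ (𝒮 : SplitSystem n) → Dec (Separating 𝒮)
Separating? 𝒮 with (anySubset? λ Y → anySubset? λ Y′ →
  (∣ Y ∣ ≟ℕ 3) ×-dec (∣ Y′ ∣ ≟ℕ 3) ×-dec ¬? (Y ≟ˢ Y′) ×-dec ¬? (Separated? 𝒮 Y Y′))
... | yes (Y , Y′ , ∣Y∣ , ∣Y′∣ , Y≢Y′ , ¬sep) = no λ sep → ¬sep (sep Y Y′ ∣Y∣ ∣Y′∣ Y≢Y′)
... | no ∄ = yes λ Y Y′ ∣Y∣ ∣Y′∣ Y≢Y′ → decidable-stable (Separated? 𝒮 Y Y′)
        λ ¬sep → ∄ (Y , Y′ , ∣Y∣ , ∣Y′∣ , Y≢Y′ , ¬sep)

Separating-mono : ∀ (𝒮 𝒮′ : SplitSystem n) → (∀ P → HasPart 𝒮 P → HasPart 𝒮′ P) →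
                  Separating 𝒮 → Separating 𝒮′
Separating-mono 𝒮 𝒮′ 𝒮⊆𝒮′ sep Y Y′ ∣Y∣ ∣Y′∣ Y≢Y′ =
  let P , has , two , two′ = sep Y Y′ ∣Y∣ ∣Y′∣ Y≢Y′ in P , 𝒮⊆𝒮′ P has , two , two′

module _ (𝒮 : SplitSystem n) where
  open SplitSystem 𝒮
  open BunemanVertex

  -- The two elements of Y in P are ends of a shortest path through v, and both of their vertices
  -- choose P at split i. The nine cases only find out which two of x, y, z they are.
  φY≡majority : ∀ {v i} → IsφY 𝒮 Y v → P isPartOf split i → TwoIn P Y → φ v i ≡ P
  φY≡majority {P = P} {v = v} {i} (x , y , z , refl , xy , yz , xz) P∣
    (a , b , a≢b , (a∈P , b∈P) , a∈Y , b∈Y) =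
    go (∈-triple⁻ x y z a∈Y) (∈-triple⁻ x y z b∈Y)
    where
    both : ∀ {a b} → OnShortestPath (buneman 𝒮) (φₓ 𝒮 a) (φₓ 𝒮 b) v → a ∈ P → b ∈ P → φ v i ≡ P
    both ab a∈P b∈P = trans
      (OnShortestPath⇒Between 𝒮 ab i
        (trans (part≡ (split i) P∣ a∈P) (sym (part≡ (split i) P∣ b∈P))))
      (part≡ (split i) P∣ a∈P)
    go : a ≡ x ⊎ a ≡ y ⊎ a ≡ z → b ≡ x ⊎ b ≡ y ⊎ b ≡ z → φ v i ≡ P
    go (inj₁ refl)        (inj₁ refl)        = ⊥-elim (a≢b refl)
    go (inj₁ refl)        (inj₂ (inj₁ refl)) = both xy a∈P b∈P
    go (inj₁ refl)        (inj₂ (inj₂ refl)) = both xz a∈P b∈P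
    go (inj₂ (inj₁ refl)) (inj₁ refl)        = both xy b∈P a∈P
    go (inj₂ (inj₁ refl)) (inj₂ (inj₁ refl)) = ⊥-elim (a≢b refl)
    go (inj₂ (inj₁ refl)) (inj₂ (inj₂ refl)) = both yz a∈P b∈P
    go (inj₂ (inj₂ refl)) (inj₁ refl)        = both xz b∈P a∈P
    go (inj₂ (inj₂ refl)) (inj₂ (inj₁ refl)) = both yz b∈P a∈P
    go (inj₂ (inj₂ refl)) (inj₂ (inj₂ refl)) = ⊥-elim (a≢b refl)

  module _ (x y z : Fin n) where
    private
      Two : Subset n → Set
      Two P = x ∈ P × y ∈ P ⊎ x ∈ P × z ∈ P ⊎ y ∈ P × z ∈ P

      majority : ∀ i → ∃[ P ] P isPartOf split i × Two P
      majority i = two-of-three (Split.A (split i)) x y z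

      -- Two pairs out of three points share a point, which is (B2) for the majority map.
      meet : Two P → Two Q → Nonempty (P ∩ Q)
      meet (inj₁ (x∈ , _))        (inj₁ (x∈′ , _))        = x , x∈p∩q⁺ (x∈ , x∈′)
      meet (inj₁ (x∈ , _))        (inj₂ (inj₁ (x∈′ , _))) = x , x∈p∩q⁺ (x∈ , x∈′)
      meet (inj₁ (_ , y∈))        (inj₂ (inj₂ (y∈′ , _))) = y , x∈p∩q⁺ (y∈ , y∈′)
      meet (inj₂ (inj₁ (x∈ , _))) (inj₁ (x∈′ , _))        = x , x∈p∩q⁺ (x∈ , x∈′)
      meet (inj₂ (inj₁ (x∈ , _))) (inj₂ (inj₁ (x∈′ , _))) = x , x∈p∩q⁺ (x∈ , x∈′)
      meet (inj₂ (inj₁ (_ , z∈))) (inj₂ (inj₂ (_ , z∈′))) = z , x∈p∩q⁺ (z∈ , z∈′)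
      meet (inj₂ (inj₂ (y∈ , _))) (inj₁ (_ , y∈′))        = y , x∈p∩q⁺ (y∈ , y∈′)
      meet (inj₂ (inj₂ (_ , z∈))) (inj₂ (inj₁ (_ , z∈′))) = z , x∈p∩q⁺ (z∈ , z∈′)
      meet (inj₂ (inj₂ (_ , z∈))) (inj₂ (inj₂ (_ , z∈′))) = z , x∈p∩q⁺ (z∈ , z∈′)

    median : BunemanVertex 𝒮
    median = record
      { φ  = λ i → proj₁ (majority i)
      ; B1 = λ i → proj₁ (proj₂ (majority i))
      ; B2 = λ i j _ → meet (proj₂ (proj₂ (majority i))) (proj₂ (proj₂ (majority j)))
      }

    -- For each of the three intervals, a majority pair contains at least one end. If both ends
    -- choose the same part, it is the part of that end, hence the majority part.
    median-isMedian : IsMedian (buneman 𝒮) (φₓ 𝒮 x) (φₓ 𝒮 y) (φₓ 𝒮 z) median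
    median-isMedian = Between⇒OnShortestPath 𝒮 xy
                    , Between⇒OnShortestPath 𝒮 yz
                    , Between⇒OnShortestPath 𝒮 xz
      where
      chosen : ∀ {w} i → w ∈ φ median i → φ median i ≡ part (split i) w
      chosen i w∈ = sym (part≡ (split i) (B1 median i) w∈)
      xy : Between 𝒮 (φₓ 𝒮 x) (φₓ 𝒮 y) median
      xy i eq with proj₂ (proj₂ (majority i))
      ... | inj₁ (x∈ , _)        = chosen i x∈
      ... | inj₂ (inj₁ (x∈ , _)) = chosen i x∈
      ... | inj₂ (inj₂ (y∈ , _)) = trans (chosen i y∈) (sym eq)
      yz : Between 𝒮 (φₓ 𝒮 y) (φₓ 𝒮 z) median
      yz i eq with proj₂ (proj₂ (majority i))
      ... | inj₁ (_ , y∈)        = chosen i y∈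
      ... | inj₂ (inj₁ (_ , z∈)) = trans (chosen i z∈) (sym eq)
      ... | inj₂ (inj₂ (y∈ , _)) = chosen i y∈
      xz : Between 𝒮 (φₓ 𝒮 x) (φₓ 𝒮 z) median
      xz i eq with proj₂ (proj₂ (majority i))
      ... | inj₁ (x∈ , _)        = chosen i x∈
      ... | inj₂ (inj₁ (x∈ , _)) = chosen i x∈
      ... | inj₂ (inj₂ (_ , z∈)) = trans (chosen i z∈) (sym eq)

  φY-exists : ∣ Y ∣ ≡ 3 → ∃ (IsφY 𝒮 Y)
  φY-exists ∣Y∣≡3 =
    let x , y , z , _ , Y≡xyz = ∣p∣≡3⇒triple ∣Y∣≡3
    in median x y z , x , y , z , Y≡xyz , median-isMedian x y z

  Separating⇒InjectiveSystem : Separating 𝒮 → InjectiveSystem 𝒮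
  Separating⇒InjectiveSystem sep {Y} {Y′} ∣Y∣ ∣Y′∣ Y≢Y′ isφ isφ′ v≈v′
    with sep Y Y′ ∣Y∣ ∣Y′∣ Y≢Y′
  ... | P , (i , P∣) , two , two′ = P≢∁P (split i) P∣
    (trans (sym (φY≡majority isφ P∣ two))
      (trans (v≈v′ i) (φY≡majority isφ′ (∁-isPartOf {S = split i} P∣) two′)))

  -- Triples that are not separated have the same majority part in every split, so their medians
  -- coincide.
  InjectiveSystem⇒Separating : InjectiveSystem 𝒮 → Separating 𝒮
  InjectiveSystem⇒Separating inj Y Y′ ∣Y∣ ∣Y′∣ Y≢Y′ =
    decidable-stable (Separated? 𝒮 Y Y′) λ ¬sep →
      let v , isφ = φY-exists ∣Y∣ ; v′ , isφ′ = φY-exists ∣Y′∣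
      in inj ∣Y∣ ∣Y′∣ Y≢Y′ isφ isφ′ λ i → agree ¬sep isφ isφ′ i
    where
    agree : ∀ {v v′} → ¬ Separated 𝒮 Y Y′ → IsφY 𝒮 Y v → IsφY 𝒮 Y′ v′ → ∀ i → φ v i ≡ φ v′ i
    agree ¬sep isφ isφ′ i
      with TwoIn-or-∁ ∣Y∣ (Split.A (split i)) | TwoIn-or-∁ ∣Y′∣ (Split.A (split i))
    ... | inj₁ t | inj₁ t′ = trans (φY≡majority isφ (inj₁ refl) t) (sym (φY≡majority isφ′ (inj₁ refl) t′))
    ... | inj₂ t | inj₂ t′ = trans (φY≡majority isφ (inj₂ refl) t) (sym (φY≡majority isφ′ (inj₂ refl) t′))
    ... | inj₁ t | inj₂ t′ = ⊥-elim (¬sep (_ , (i , inj₁ refl) , t , t′))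
    ... | inj₂ t | inj₁ t′ = ⊥-elim (¬sep (Separated-sym 𝒮 (_ , (i , inj₁ refl) , t′ , t)))

-- Incompatible families and cubes

IncompatibleFamily : SplitSystem n → ℕ → Set
IncompatibleFamily 𝒮 k = Σ[ f ∈ (Fin k → Fin card) ] ∀ c c′ → c ≢ c′ →
  Incompatible (split (f c)) (split (f c′))
  where open SplitSystem 𝒮

IncompatibleFamily? : ∀ (𝒮 : SplitSystem n) k → Dec (IncompatibleFamily 𝒮 k)
IncompatibleFamily? 𝒮 k = map′
  (λ (i , inc) → finToFun i , inc)
  (λ (f , inc) → funToFin f , λ c c′ c≢c′ → subst₂ (λ i j → Incompatible (split i) (split j))
    (sym (finToFun-funToFin f c)) (sym (finToFun-funToFin f c′)) (inc c c′ c≢c′))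
  -- A map from `Fin k` to `Fin card` is one of `card ^ k` codes; it is recovered from its code
  -- pointwise.
  (any? {n = card ^ k} λ i → all? λ c → all? λ c′ →
    ¬? (c ≟ c′) →-dec Incompatible? (split (finToFun i c)) (split (finToFun i c′)))
  where open SplitSystem 𝒮

IncompatibleFamily-mono : ∀ (𝒮 𝒮′ : SplitSystem n) → (∀ P → HasPart 𝒮 P → HasPart 𝒮′ P) →
                          IncompatibleFamily 𝒮 k → IncompatibleFamily 𝒮′ k
IncompatibleFamily-mono 𝒮 𝒮′ 𝒮⊆𝒮′ (f , inc) = g , λ c c′ c≢c′ _ _ P∣ Q∣ →
    inc c c′ c≢c′ _ _ (back c P∣) (back c′ Q∣)
  where
  module 𝒮  = SplitSystem 𝒮
  module 𝒮′ = SplitSystem 𝒮′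
  has : ∀ c → HasPart 𝒮′ (Split.A (𝒮.split (f c)))
  has c = 𝒮⊆𝒮′ _ (f c , inj₁ refl)
  g = proj₁ ∘ has
  back : ∀ c {P} → P isPartOf 𝒮′.split (g c) → P isPartOf 𝒮.split (f c)
  back c P∣ = isPartOf-≈ˢ (𝒮′.split (g c)) (𝒮.split (f c))
    (common-part⇒≈ˢ (𝒮′.split (g c)) (𝒮.split (f c)) (proj₂ (has c)) (inj₁ refl)) P∣

module _ (𝒮 : SplitSystem n) where
  open SplitSystem 𝒮
  open BunemanVertex
  open Graph (buneman 𝒮) using (_≈_; _~_)

  IncompatibleFamily-injective : ∀ ((f , _) : IncompatibleFamily 𝒮 k) → Injective _≡_ _≡_ f
  IncompatibleFamily-injective (f , inc) {c} {c′} fc≡fc′ with c ≟ c′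
  ... | yes eq  = eq
  ... | no c≢c′ = ⊥-elim (Incompatible⇒≉ˢ (split (f c)) (split (f c′)) (inc c c′ c≢c′)
                    (inj₁ (cong (Split.A ∘ split) fc≡fc′)))

  -- Opposite edges of a 4-cycle in the Buneman graph switch the same split.

  fixed : ∀ {u v} (e : u ~ v) {l} → l ≢ proj₁ e → φ u l ≡ φ v l
  fixed {u} {v} (i , _ , unique) {l} l≢i =
    decidable-stable (φ u l ≟ˢ φ v l) λ neq → l≢i (sym (unique neq))

  flipped-≢ : ∀ {a b d} (ab : a ~ b) (ad : a ~ d) → ¬ b ≈ d → proj₁ ab ≢ proj₁ ad
  flipped-≢ {a} {b} {d} ab@(i , ai≢bi , _) ad@(_ , ai≢di , _) b≉d refl = b≉d b≈d
    where
    b≈d : b ≈ d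
    b≈d l with l ≟ i
    ... | yes refl = two-parts (split i) (B1 a i) (B1 b i) (B1 d i) ai≢bi ai≢di
    ... | no l≢i   = trans (sym (fixed {a} {b} ab l≢i)) (fixed {a} {d} ad l≢i)

  -- Otherwise the edge dc would undo the switch made by ad, and a would coincide with c.
  opposite : ∀ {a b c d} (ab : a ~ b) (bc : b ~ c) (dc : d ~ c) (ad : a ~ d) →
             ¬ a ≈ c → ¬ b ≈ d → φ b (proj₁ ad) ≢ φ c (proj₁ ad)
  opposite {a} {b} {c} {d} ab bc dc@(m , _ , unique) ad@(j , aj≢dj , _) a≉c b≉d bj≡cj = a≉c a≈c
    where
    aj≡cj : φ a j ≡ φ c j
    aj≡cj = trans (fixed {a} {b} ab (flipped-≢ {a} {b} {d} ab ad b≉d ∘ sym)) bj≡cj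
    m≡j : m ≡ j
    m≡j = unique λ dj≡cj → aj≢dj (trans aj≡cj (sym dj≡cj))
    a≈c : a ≈ c
    a≈c l with l ≟ j
    ... | yes refl = aj≡cj
    ... | no l≢j   = trans (fixed {a} {d} ad l≢j)
                       (fixed {d} {c} dc λ l≡m → l≢j (trans l≡m m≡j))

  -- The corners a, b, d, c realise the four combinations of parts of the two splits, and (B2) at
  -- each corner makes the corresponding intersection non-empty.
  square⇒Incompatible : ∀ {a b c d} (ab : a ~ b) (bc : b ~ c) (dc : d ~ c) (ad : a ~ d) →
    ¬ a ≈ c → ¬ b ≈ d → Incompatible (split (proj₁ ab)) (split (proj₁ ad))
  square⇒Incompatible {a} {b} {c} {d} ab@(i , ai≢bi , _) bc dc ad@(j , aj≢dj , _) a≉c b≉d P Q P∣ Q∣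
    with P ≟ˢ φ a i | Q ≟ˢ φ a j
  ... | yes refl | yes refl = B2 a i j i≢j
    where i≢j = flipped-≢ {a} {b} {d} ab ad b≉d
  ... | yes refl | no Q≢ = subst₂ (λ P Q → Nonempty (P ∩ Q)) (sym (fixed {a} {d} ad i≢j))
      (two-parts (split j) (B1 a j) (B1 d j) Q∣ aj≢dj (Q≢ ∘ sym)) (B2 d i j i≢j)
    where i≢j = flipped-≢ {a} {b} {d} ab ad b≉d
  ... | no P≢ | yes refl = subst₂ (λ P Q → Nonempty (P ∩ Q))
      (two-parts (split i) (B1 a i) (B1 b i) P∣ ai≢bi (P≢ ∘ sym))
      (sym (fixed {a} {b} ab (i≢j ∘ sym))) (B2 b i j i≢j)
    where i≢j = flipped-≢ {a} {b} {d} ab ad b≉d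
  ... | no P≢ | no Q≢ = subst₂ (λ P Q → Nonempty (P ∩ Q))
      (two-parts (split i) (B1 a i) (B1 c i) P∣
        (λ eq → opposite {a} {d} {c} {b} ad dc bc ab a≉c (λ d≈b → b≉d (sym ∘ d≈b))
                  (trans (sym (fixed {a} {d} ad i≢j)) eq)) (P≢ ∘ sym))
      (two-parts (split j) (B1 a j) (B1 c j) Q∣
        (λ eq → opposite {a} {b} {c} {d} ab bc dc ad a≉c b≉d
                  (trans (sym (fixed {a} {b} ab (i≢j ∘ sym))) eq)) (Q≢ ∘ sym))
      (B2 c i j i≢j)
    where i≢j = flipped-≢ {a} {b} {d} ab ad b≉d

  -- The splits are those switched by the k edges at the image of the zero vector. Any two of these
  -- edges span the image of a square, whose opposite corners stay distinct because the embedding is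
  -- injective.
  Contains⇒IncompatibleFamily : Contains (buneman 𝒮) (hypercube k) → IncompatibleFamily 𝒮 k
  Contains⇒IncompatibleFamily {k} (f , _ , injective , hom) =
    (λ c → proj₁ (o~e c)) , λ c c′ c≢c′ →
      square⇒Incompatible {f o} {f (e c)} {f (e c [ c′ ]≔ true)} {f (e c′)} (o~e c)
        (hom (raise (e c) c′ (lookup-e c′ c (c≢c′ ∘ sym))))
        (subst (λ w → f (e c′) ~ f w) (sym ([]≔-commutes o c c′ c≢c′))
          (hom (raise (e c′) c (lookup-e c c′ c≢c′))))
        (o~e c′)
        (λ o≈ → case-false (trans (sym (lookup-replicate c false))
           (trans (cong (λ w → lookup w c) (injective o≈))
             (trans (lookup∘updateAt′ c c′ c≢c′ (e c)) (lookup∘updateAt c o)))))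
        (λ e≈ → case-false (trans (sym (lookup-e c c′ c≢c′))
           (trans (cong (λ w → lookup w c) (sym (injective e≈))) (lookup∘updateAt c o))))
    where
    module Q = Graph (hypercube k)
    o : Vec Bool k
    o = replicate k false
    e : Fin k → Vec Bool k
    e c = o [ c ]≔ true
    case-false : false ≢ true
    case-false ()
    raise : ∀ u c → lookup u c ≡ false → u Q.~ (u [ c ]≔ true)
    raise u c uc≡false =
        c , (λ eq → case-false (trans (sym uc≡false) (trans eq (lookup∘updateAt c u)))) , unique
      where
      unique : ∀ {i} → lookup u i ≢ lookup (u [ c ]≔ true) i → c ≡ i
      unique {i} neq with c ≟ i
      ... | yes eq = eq
      ... | no c≢i = ⊥-elim (neq (sym (lookup∘updateAt′ i c (c≢i ∘ sym) u)))
    o~e : ∀ c → f o ~ f (e c)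
    o~e c = hom (raise o c (lookup-replicate c false))
    lookup-e : ∀ c c′ → c ≢ c′ → lookup (e c′) c ≡ false
    lookup-e c c′ c≢c′ = trans (lookup∘updateAt′ c c′ c≢c′ o) (lookup-replicate c false)

  -- The cube of an incompatible family: its vertices choose the parts of the
  -- splits in the family freely and agree on all other splits.  A split that
  -- is compatible with some split of the family has a part which contains a
  -- part of the latter; any other split takes its part containing x.
  module _ (family : IncompatibleFamily 𝒮 k) (x : Fin n) where

    private
      f : Fin k → Fin card
      f = proj₁ family

      inc : ∀ c c′ → c ≢ c′ → Incompatible (split (f c)) (split (f c′))
      inc = proj₂ family

      Meeting : Subset n → Set
      Meeting Q = ∀ c P → P isPartOf split (f c) → Nonempty (P ∩ Q)

      Anchored : Subset n → Set
      Anchored Q = (∃[ c ] ∃[ P ] P isPartOf split (f c) × P ⊆ Q) ⊎ x ∈ Q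

      frozen : ∀ j → ¬ (∃[ c ] f c ≡ j) → ∃[ Q ] Q isPartOf split j × Meeting Q × Anchored Q
      frozen j j∉f with any? (λ c → ¬? (Incompatible? (split (f c)) (split j)))
      ... | no ∄c = part (split j) x , part-isPartOf (split j) x
          , (λ c _ P∣ → decidable-stable (Incompatible? (split (f c)) (split j))
               (λ ¬inc → ∄c (c , ¬inc)) _ _ P∣ (part-isPartOf (split j) x))
          , inj₂ (x∈part (split j) x)
      ... | yes (c , ¬inc) with Incompatible-or-disjoint-parts (split (f c)) (split j)
      ...   | inj₁ inc-c = ⊥-elim (¬inc inc-c)
      ...   | inj₂ (Z , P , Z∣ , P∣ , disjoint) = ∁ P , ∁-isPartOf {S = split j} P∣ , meets
          , inj₁ (c , Z , Z∣ , Z⊆∁P)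
        where
        Z⊆∁P : Z ⊆ ∁ P
        Z⊆∁P z∈ = x∉p⇒x∈∁p (disjoint z∈)
        -- Z and P are disjoint. If they also covered X, split j would be the member c of the
        -- family, against `j∉f`. So `∁ P` meets `∁ Z` besides containing Z, and every part of
        -- another member meets Z by incompatibility.
        ∁Z≢P : ∁ Z ≢ P
        ∁Z≢P refl = j∉f (c , distinct (common-part⇒≈ˢ (split (f c)) (split j)
                      (∁-isPartOf {S = split (f c)} Z∣) P∣))
        ∁Z∩∁P : Nonempty (∁ Z ∩ ∁ P)
        ∁Z∩∁P = decidable-stable (nonempty? (∁ Z ∩ ∁ P)) λ empty → ∁Z≢P (⊆-antisym
          (λ {y} y∈∁Z → x∉∁p⇒x∈p λ y∈∁P → empty (y , x∈p∩q⁺ (y∈∁Z , y∈∁P)))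
          (λ y∈P → x∉p⇒x∈∁p λ y∈Z → disjoint y∈Z y∈P))
        meets : Meeting (∁ P)
        meets c′ Z′ Z′∣ with c′ ≟ c
        ... | no c′≢c = let y , y∈ = inc c′ c c′≢c Z′ Z Z′∣ Z∣ ; y∈Z′ , y∈Z = x∈p∩q⁻ Z′ Z y∈
                        in y , x∈p∩q⁺ (y∈Z′ , Z⊆∁P y∈Z)
        ... | yes refl with isPartOf⇒≡∨≡∁ (split (f c)) Z∣ Z′∣
        ...   | inj₁ refl = let y , y∈Z = part≢∅ (split (f c)) Z∣ in y , x∈p∩q⁺ (y∈Z , Z⊆∁P y∈Z)
        ...   | inj₂ refl = ∁Z∩∁P

      -- If one of the two sets contains a part of a family member, the other meets that part; if
      -- neither is anchored in this way, both contain x.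
      frozen-meet : Meeting P → Anchored P → Meeting Q → Anchored Q → Nonempty (P ∩ Q)
      frozen-meet {P} {Q} mP aP mQ (inj₁ (c , Z , Z∣ , Z⊆Q)) =
        let y , y∈ = mP c Z Z∣ ; y∈Z , y∈P = x∈p∩q⁻ Z P y∈ in y , x∈p∩q⁺ (y∈P , Z⊆Q y∈Z)
      frozen-meet {P} {Q} mP (inj₁ (c , Z , Z∣ , Z⊆P)) mQ (inj₂ _) =
        let y , y∈ = mQ c Z Z∣ ; y∈Z , y∈Q = x∈p∩q⁻ Z Q y∈ in y , x∈p∩q⁺ (Z⊆P y∈Z , y∈Q)
      frozen-meet mP (inj₂ x∈P) mQ (inj₂ x∈Q) = x , x∈p∩q⁺ (x∈P , x∈Q)

      side : Bool → Split n → Subset n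
      side b S = if b then Split.A S else ∁ (Split.A S)

      side-isPartOf : ∀ b S → side b S isPartOf S
      side-isPartOf true  S = inj₁ refl
      side-isPartOf false S = inj₂ refl

      side-injective : ∀ {b b′} S → side b S ≡ side b′ S → b ≡ b′
      side-injective {true}  {true}  S eq = refl
      side-injective {true}  {false} S eq = ⊥-elim (P≢∁P S (inj₁ refl) eq)
      side-injective {false} {true}  S eq = ⊥-elim (P≢∁P S (inj₁ refl) (sym eq))
      side-injective {false} {false} S eq = refl

      member? : ∀ j → Dec (∃[ c ] f c ≡ j)
      member? j = any? λ c → f c ≟ j

      -- The membership decision is an argument, so that properties of the corners can be proved by
      -- cases on it.
      value : Vec Bool k → ∀ j → Dec (∃[ c ] f c ≡ j) → Subset n
      value b j (yes (c , _)) = side (lookup b c) (split j)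
      value b j (no ∄c)       = proj₁ (frozen j ∄c)

      value-isPartOf : ∀ b j d → value b j d isPartOf split j
      value-isPartOf b j (yes (c , _)) = side-isPartOf (lookup b c) (split j)
      value-isPartOf b j (no ∄c)       = proj₁ (proj₂ (frozen j ∄c))

      value-meet : ∀ b i j → i ≢ j → ∀ d d′ → Nonempty (value b i d ∩ value b j d′)
      value-meet b _ _ i≢j (yes (c , refl)) (yes (c′ , refl)) =
        inc c c′ (i≢j ∘ cong f) _ _
          (side-isPartOf (lookup b c) (split (f c))) (side-isPartOf (lookup b c′) (split (f c′)))
      value-meet b _ j i≢j (yes (c , refl)) (no ∄c) =
        proj₁ (proj₂ (proj₂ (frozen j ∄c))) c _ (side-isPartOf (lookup b c) (split (f c)))
      value-meet b i _ i≢j (no ∄c) (yes (c , refl)) = subst Nonempty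
        (∩-comm (side (lookup b c) (split (f c))) _)
        (proj₁ (proj₂ (proj₂ (frozen i ∄c))) c _ (side-isPartOf (lookup b c) (split (f c))))
      value-meet b i j i≢j (no ∄c) (no ∄c′) =
        let _ , _ , m , a = frozen i ∄c ; _ , _ , m′ , a′ = frozen j ∄c′ in frozen-meet m a m′ a′

      corner : Vec Bool k → BunemanVertex 𝒮
      corner b = record
        { φ  = λ j → value b j (member? j)
        ; B1 = λ j → value-isPartOf b j (member? j)
        ; B2 = λ i j i≢j → value-meet b i j i≢j (member? i) (member? j)
        }

      corner-f : ∀ b c → φ (corner b) (f c) ≡ side (lookup b c) (split (f c))
      corner-f b c with member? (f c)
      ... | yes (c′ , eq) =
        cong (λ l → side (lookup b l) (split (f c))) (IncompatibleFamily-injective family eq)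
      ... | no ∄c = ⊥-elim (∄c (c , refl))

      corner-injective : ∀ {b b′} → corner b ≈ corner b′ → b ≡ b′
      corner-injective {b} {b′} b≈b′ = trans (sym (tabulate∘lookup b)) (trans
        (tabulate-cong λ c → side-injective (split (f c))
          (trans (sym (corner-f b c)) (trans (b≈b′ (f c)) (corner-f b′ c))))
        (tabulate∘lookup b′))

      corner-~ : ∀ {b b′} → Graph._~_ (hypercube k) b b′ → corner b ~ corner b′
      corner-~ {b} {b′} (c , bc≢b′c , unique) = f c
          , (λ eq → bc≢b′c (side-injective (split (f c))
              (trans (sym (corner-f b c)) (trans eq (corner-f b′ c)))))
          , λ {j} → unique-j j (member? j)
        where
        unique-j : ∀ j d → value b j d ≢ value b′ j d → f c ≡ j
        unique-j j (yes (c′ , refl)) neq = cong f (unique λ eq → neq (cong (λ s → side s (split j)) eq))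
        unique-j j (no _)            neq = ⊥-elim (neq refl)

    IncompatibleFamily⇒Contains : Contains (buneman 𝒮) (hypercube k)
    IncompatibleFamily⇒Contains = corner , (λ { refl _ → refl }) , corner-injective , corner-~

  -- The splits of an incompatible family are distinct, so `card` bounds the dimension; the empty
  -- family gives the 0-cube. The point x is the default used for cubes.
  IsDim-exists : Fin n → ∃ (IsDim 𝒮)
  IsDim-exists x = IsMax-exists
    (λ k → map′ (λ fam → IncompatibleFamily⇒Contains fam x) Contains⇒IncompatibleFamily
             (IncompatibleFamily? 𝒮 k))
    (IncompatibleFamily⇒Contains ((λ ()) , λ ()) x)
    card λ k cube → injective⇒≤ (IncompatibleFamily-injective (Contains⇒IncompatibleFamily cube))

IsDim-cong : ∀ (𝒮 𝒮′ : SplitSystem n) → Fin n → (∀ P → HasPart 𝒮 P → HasPart 𝒮′ P) →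
             (∀ P → HasPart 𝒮′ P → HasPart 𝒮 P) → ∀ {d} → IsDim 𝒮 d → IsDim 𝒮′ d
IsDim-cong 𝒮 𝒮′ x 𝒮⊆𝒮′ 𝒮′⊆𝒮 {d} (cube , max) =
    transfer 𝒮 𝒮′ 𝒮⊆𝒮′ d cube , λ k cube′ → max k (transfer 𝒮′ 𝒮 𝒮′⊆𝒮 k cube′)
  where
  transfer : ∀ (𝒮 𝒮′ : SplitSystem _) → (∀ P → HasPart 𝒮 P → HasPart 𝒮′ P) →
             ∀ k → Contains (buneman 𝒮) (hypercube k) → Contains (buneman 𝒮′) (hypercube k)
  transfer 𝒮 𝒮′ 𝒮⊆𝒮′ k cube = IncompatibleFamily⇒Contains 𝒮′
    (IncompatibleFamily-mono 𝒮 𝒮′ 𝒮⊆𝒮′ (Contains⇒IncompatibleFamily 𝒮 cube)) x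

-- Split systems given by pairs of points

≈ˢ-decSetoid : ℕ → DecSetoid 0ℓ 0ℓ
≈ˢ-decSetoid n = record
  { Carrier = Split n
  ; _≈_     = _≈ˢ_
  ; isDecEquivalence = record
    { isEquivalence = record
      { refl  = inj₁ refl
      ; sym   = λ {S} {T} S≈T → common-part⇒≈ˢ T S S≈T (inj₁ refl)
      ; trans = λ {S} {T} {U} S≈T T≈U → isPartOf-≈ˢ T U T≈U S≈T
      }
    ; _≟_ = λ S T → (Split.A S ≟ˢ Split.A T) ⊎-dec (Split.A S ≟ˢ ∁ (Split.A T))
    }
  }

AllPairs-lookup-injective : ∀ {A : Set} {_~_ : Rel A 0ℓ} → Symmetric _~_ → ∀ {xs} →
  AllPairs (λ x y → ¬ x ~ y) xs → ∀ {i j} → List.lookup xs i ~ List.lookup xs j → i ≡ j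
AllPairs-lookup-injective s (x∉ ∷ xs!) {zero}  {zero}  eq = refl
AllPairs-lookup-injective s (x∉ ∷ xs!) {zero}  {suc j} eq = ⊥-elim (All.lookup x∉ (∈-lookup j) eq)
AllPairs-lookup-injective s (x∉ ∷ xs!) {suc i} {zero}  eq = ⊥-elim (All.lookup x∉ (∈-lookup i) (s eq))
AllPairs-lookup-injective s (x∉ ∷ xs!) {suc i} {suc j} eq = cong suc (AllPairs-lookup-injective s xs! eq)

∣pair-xx∣≡1 : ∀ (x : Fin n) → ∣ pair x x ∣ ≡ 1
∣pair-xx∣≡1 x = trans (cong ∣_∣ (∪-idem ⁅ x ⁆)) (∣⁅x⁆∣≡1 x)

∣pair∣≡2 : x ≢ y → ∣ pair x y ∣ ≡ 2
∣pair∣≡2 {x = x} {y} x≢y = ≤-antisym (∣pair∣≤2 x y) (≤-trans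
  (≤-reflexive (sym (cong₂ _+_ (∣⁅x⁆∣≡1 x) (∣⁅x⁆∣≡1 y))))
  (disjoint⇒∣p∣+∣q∣≤∣p∪q∣ ⁅ x ⁆ ⁅ y ⁆ λ w∈x w∈y →
    x≢y (trans (sym (x∈⁅y⁆⇒x≡y x w∈x)) (x∈⁅y⁆⇒x≡y y w∈y))))

HasPart? : ∀ (𝒮 : SplitSystem n) P → Dec (HasPart 𝒮 P)
HasPart? 𝒮 P = any? λ i → (P ≟ˢ Split.A (split i)) ⊎-dec (P ≟ˢ ∁ (Split.A (split i)))
  where open SplitSystem 𝒮

pair-xx-HasPart : ∀ (𝒮 : SplitSystem n) x → HasPart 𝒮 (pair x x)
pair-xx-HasPart 𝒮 x = subst (HasPart 𝒮) (sym (∪-idem ⁅ x ⁆)) (SplitSystem.trivials 𝒮 x)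

Small : SplitSystem n → Set
Small 𝒮 = ∀ i → ¬ Trivial (split i) → size (split i) ≡ 2
  where open SplitSystem 𝒮

-- The smaller part has one or two points; a trivial split gives x = y.
pair-isPartOf : ∀ (𝒮 : SplitSystem n) → Small 𝒮 →
                ∀ i → ∃₂ λ x y → pair x y isPartOf SplitSystem.split 𝒮 i
pair-isPartOf 𝒮 small i with ⊓-sel ∣ A ∣ ∣ ∁ A ∣
  where open Split (SplitSystem.split 𝒮 i)
... | eq = [ (λ eq → build (inj₁ refl) (≤-trans (≤-reflexive (sym eq)) size≤2))
           , (λ eq → build (inj₂ refl) (≤-trans (≤-reflexive (sym eq)) size≤2)) ]′ eq
  where
  Sᵢ = SplitSystem.split 𝒮 i
  size≤2 : size Sᵢ ≤ 2
  size≤2 with size Sᵢ ≟ℕ 1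
  ... | yes eq = ≤-trans (≤-reflexive eq) (s≤s z≤n)
  ... | no neq = ≤-reflexive (small i neq)
  build : ∀ {P} → P isPartOf Sᵢ → ∣ P ∣ ≤ 2 → ∃₂ λ x y → pair x y isPartOf Sᵢ
  build P∣ ∣P∣≤2 =
    let x , y , P≡ = Nonempty∧∣p∣≤2⇒pair (part≢∅ Sᵢ P∣) ∣P∣≤2
    in x , y , subst (_isPartOf Sᵢ) P≡ P∣

module _ (5≤n : 5 ≤ n) where

  private
    2<n : 2 < n
    2<n = ≤-trans (s≤s (s≤s (s≤s z≤n))) 5≤n

  pairSplit : Fin n → Fin n → Split n
  pairSplit x y = record
    { A    = pair x y
    ; A≢∅  = x , ∈-pairˡ x y
    ; ∁A≢∅ = ∣p∣<n⇒∁p≢∅ (pair x y) (≤-<-trans (∣pair∣≤2 x y) 2<n)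
    }

  size-pairSplit : ∀ x y {m} → m ≤ 2 → ∣ pair x y ∣ ≡ m → size (pairSplit x y) ≡ m
  size-pairSplit x y {m} m≤2 eq = begin
    ∣ pair x y ∣ ⊓ ∣ ∁ (pair x y) ∣  ≡⟨ cong₂ _⊓_ eq (∣∁p∣≡n∸∣p∣ (pair x y)) ⟩
    m ⊓ (n ∸ ∣ pair x y ∣)           ≡⟨ cong (λ l → m ⊓ (n ∸ l)) eq ⟩
    m ⊓ (n ∸ m)                      ≡⟨ m≤n⇒m⊓n≡m (≤-trans m≤2 (≤-trans (n≤1+n 2)
                                          (∸-mono 5≤n m≤2))) ⟩
    m                                ∎
    where open ≡-Reasoning

  pairSplit-small : ∀ x y → ¬ Trivial (pairSplit x y) → size (pairSplit x y) ≡ 2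
  pairSplit-small x y nontrivial with x ≟ y
  ... | yes refl = ⊥-elim (nontrivial (size-pairSplit x x (s≤s z≤n) (∣pair-xx∣≡1 x)))
  ... | no x≢y   = size-pairSplit x y ≤-refl (∣pair∣≡2 x≢y)

  -- The trivial splits come from x = y.
  module _ (R : Fin n → Fin n → Set) (R? : ∀ x y → Dec (R x y)) (R-refl : ∀ x → R x x) where

    private
      splits : List (Split n)
      splits = List.map (uncurry pairSplit)
        (filter (uncurry R?) (cartesianProduct (allFin n) (allFin n)))

      open DecSetoid (≈ˢ-decSetoid n) using () renaming (_≟_ to _≈ˢ?_)

      -- `pairSplit x y` and `pairSplit y x` are the same split, so `distinct` requires removing
      -- repetitions up to `≈ˢ`.
      distinctSplits : List (Split n)
      distinctSplits = deduplicate _≈ˢ?_ splits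

      ∈-splits⁺ : ∀ {x y} → R x y → pairSplit x y ∈ˡ splits
      ∈-splits⁺ {x} {y} Rxy = ∈-map⁺ (uncurry pairSplit)
        (∈-filter⁺ (uncurry R?) (∈-cartesianProduct⁺ (∈-allFin x) (∈-allFin y)) Rxy)

      lookup-distinctSplits : ∀ i → ∃₂ λ x y → R x y × List.lookup distinctSplits i ≡ pairSplit x y
      lookup-distinctSplits i
        with ∈-map⁻ (uncurry pairSplit) (∈-deduplicate⁻ _≈ˢ?_ splits (∈-lookup i))
      ... | (x , y) , xy∈ , eq = x , y
        , proj₂ (∈-filter⁻ (uncurry R?) {xs = cartesianProduct (allFin n) (allFin n)} xy∈) , eq

      hasPart : ∀ {x y P} → R x y → P isPartOf pairSplit x y →
                ∃[ i ] P isPartOf List.lookup distinctSplits i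
      hasPart {x} {y} {P} Rxy P∣ = Any.index P∈ , Any.lookup-index P∈
        where
        P∈ : Any (P isPartOf_) distinctSplits
        P∈ = Any.deduplicate⁺ _≈ˢ?_
          (λ {S} {T} T≈S → isPartOf-≈ˢ S T (DecSetoid.sym (≈ˢ-decSetoid n) {T} {S} T≈S))
          (lose (∈-splits⁺ Rxy) P∣)

    pairSystem : SplitSystem n
    pairSystem = record
      { card     = length distinctSplits
      ; split    = List.lookup distinctSplits
      ; distinct = AllPairs-lookup-injective
          (λ {S} {T} → DecSetoid.sym (≈ˢ-decSetoid n) {S} {T})
          (deduplicate-! (≈ˢ-decSetoid n) splits)
      ; trivials = λ x → hasPart (R-refl x) (inj₁ (sym (∪-idem ⁅ x ⁆)))
      }

    pairSystem-HasPart⁺ : ∀ {P} x y → R x y → P isPartOf pairSplit x y → HasPart pairSystem P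
    pairSystem-HasPart⁺ x y = hasPart

    pairSystem-HasPart⁻ : ∀ {P} → HasPart pairSystem P →
                          ∃₂ λ x y → R x y × P isPartOf pairSplit x y
    pairSystem-HasPart⁻ {P} (i , P∣) =
      let x , y , Rxy , eq = lookup-distinctSplits i
      in x , y , Rxy , subst (P isPartOf_) eq P∣

    pairSystem-small : Small pairSystem
    pairSystem-small i nontrivial with lookup-distinctSplits i
    ... | x , y , _ , eq = trans (cong size eq)
      (pairSplit-small x y (nontrivial ∘ trans (cong size eq)))

  -- Every system of splits of size at most 2 is encoded by a subset of Fin (n * n).

  module _ (I : Subset (n * n)) where
    -- The diagonal is always included, so that every subset of `Fin (n * n)` codes a system with
    -- all trivial splits.
    InCode : Fin n → Fin n → Set
    InCode x y = x ≡ y ⊎ combine x y ∈ I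

    InCode? : ∀ x y → Dec (InCode x y)
    InCode? x y = (x ≟ y) ⊎-dec (combine x y ∈? I)

    InCode-refl : ∀ x → InCode x x
    InCode-refl x = inj₁ refl

    decode : SplitSystem n
    decode = pairSystem InCode InCode? InCode-refl

  module _ (𝒮 : SplitSystem n) (small : Small 𝒮) where
    private
      coded? : ∀ i → Dec (HasPart 𝒮 (uncurry pair (remQuot n i)))
      coded? i = HasPart? 𝒮 (uncurry pair (remQuot n i))

    encode : Subset (n * n)
    encode = comprehension coded?

    decode-encode⁺ : ∀ P → HasPart 𝒮 P → HasPart (decode encode) P
    decode-encode⁺ P (i , P∣) with pair-isPartOf 𝒮 small i
    ... | x , y , xy∣ = pairSystem-HasPart⁺ _ (InCode? encode) (InCode-refl encode) x y
      (inj₂ (∈-comprehension⁺ coded? (subst (λ xy → HasPart 𝒮 (uncurry pair xy))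
        (sym (remQuot-combine x y)) (i , xy∣))))
      (isPartOf⇒≡∨≡∁ (SplitSystem.split 𝒮 i) xy∣ P∣)

    decode-encode⁻ : ∀ P → HasPart (decode encode) P → HasPart 𝒮 P
    decode-encode⁻ P has with pairSystem-HasPart⁻ _ (InCode? encode) (InCode-refl encode) has
    ... | x , y , inCode , P∣ = [ (λ { refl → xy-HasPart }) , (λ { refl → HasPart-∁ 𝒮 xy-HasPart }) ]′ P∣
      where
      to-HasPart : ∀ {x y} → InCode encode x y → HasPart 𝒮 (pair x y)
      to-HasPart {x} (inj₁ refl) = pair-xx-HasPart 𝒮 x
      to-HasPart {x} {y} (inj₂ xy∈) = subst (λ xy → HasPart 𝒮 (uncurry pair xy))
        (remQuot-combine x y) (∈-comprehension⁻ coded? xy∈)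
      xy-HasPart : HasPart 𝒮 (pair x y)
      xy-HasPart = to-HasPart inCode

  -- Deciding which dimensions occur

  InjectiveDim : ℕ → Set
  InjectiveDim d = Σ[ 𝒮 ∈ SplitSystem n ] In𝕊₂ 𝒮 × IsDim 𝒮 d

  private
    o : Fin n
    o = fromℕ< 2<n

  InjectiveDim? : ∀ d → Dec (InjectiveDim d)
  InjectiveDim? d = map′
    (λ (I , sep , dim) → decode I
       , (Separating⇒InjectiveSystem (decode I) sep , pairSystem-small _ (InCode? I) (InCode-refl I)) , dim)
    (λ (𝒮 , (inj , small) , dim) → encode 𝒮 small
       , Separating-mono 𝒮 (decode (encode 𝒮 small)) (decode-encode⁺ 𝒮 small)
           (InjectiveSystem⇒Separating 𝒮 inj)
       , IsDim-cong 𝒮 (decode (encode 𝒮 small)) o (decode-encode⁺ 𝒮 small) (decode-encode⁻ 𝒮 small) dim)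
    (anySubset? λ I → Separating? (decode I) ×-dec IsDim? I)
    where
    -- The dimension exists and is unique, so deciding `IsDim` amounts to comparing it with d.
    IsDim? : ∀ I → Dec (IsDim (decode I) d)
    IsDim? I with IsDim-exists (decode I) o
    ... | m , dim = map′ (λ { refl → dim }) (IsMax-unique dim) (m ≟ℕ d)

-- Lower bound

-- The four intersections contain a, b, c and a point outside these three, which exists because 3 <
-- n.
pairs-Incompatible : ∀ {n} {a b c : Fin n} {S T : Split n} → 3 < n → a ≢ b → a ≢ c → b ≢ c →
  pair a b isPartOf S → pair a c isPartOf T → Incompatible S T
pairs-Incompatible {a = a} {b} {c} {S} {T} 3<n a≢b a≢c b≢c ab∣ ac∣ P Q P∣ Q∣
  with isPartOf⇒≡∨≡∁ S ab∣ P∣ | isPartOf⇒≡∨≡∁ T ac∣ Q∣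
... | inj₁ refl | inj₁ refl = a , x∈p∩q⁺ (∈-pairˡ a b , ∈-pairˡ a c)
... | inj₁ refl | inj₂ refl = b , x∈p∩q⁺ (∈-pairʳ a b , ∉-pair a c (a≢b ∘ sym) b≢c)
... | inj₂ refl | inj₁ refl = c , x∈p∩q⁺ (∉-pair a b (a≢c ∘ sym) (b≢c ∘ sym) , ∈-pairʳ a c)
... | inj₂ refl | inj₂ refl with ∣p∣<n⇒∁p≢∅ (triple a b c) (≤-<-trans (∣triple∣≤3 a b c) 3<n)
...   | w , w∈ = w , x∈p∩q⁺ (∉-pair a b w≢a w≢b , ∉-pair a c w≢a w≢c)
  where
  w∉ = x∈∁p⇒x∉p w∈
  w≢a = λ w≡a → w∉ (subst (_∈ triple a b c) (sym w≡a) (∈-triple₁ a b c))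
  w≢b = λ w≡b → w∉ (subst (_∈ triple a b c) (sym w≡b) (∈-triple₂ a b c))
  w≢c = λ w≡c → w∉ (subst (_∈ triple a b c) (sym w≡c) (∈-triple₃ a b c))

module _ (𝒮 : SplitSystem n) where
  open SplitSystem 𝒮

  Edge : Fin n → Fin n → Set
  Edge x y = x ≢ y × HasPart 𝒮 (pair x y)

  Edge? : ∀ x y → Dec (Edge x y)
  Edge? x y = ¬? (x ≟ y) ×-dec HasPart? 𝒮 (pair x y)

  Edge-sym : Edge x y → Edge y x
  Edge-sym {x} {y} (x≢y , has) = x≢y ∘ sym , subst (HasPart 𝒮) (∪-comm ⁅ x ⁆ ⁅ y ⁆) has

  neighbours : Fin n → Subset n
  neighbours x = comprehension (Edge? x)

  star : 3 < n → ∀ x → IncompatibleFamily 𝒮 ∣ neighbours x ∣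
  star 3<n x = (λ i → proj₁ (proj₂ (edge i))) , λ i j i≢j →
      pairs-Incompatible {S = split (proj₁ (proj₂ (edge i)))} {T = split (proj₁ (proj₂ (edge j)))}
        3<n (proj₁ (edge i)) (proj₁ (edge j)) (i≢j ∘ enumerate-injective (neighbours x))
        (proj₂ (proj₂ (edge i))) (proj₂ (proj₂ (edge j)))
    where
    edge : ∀ i → Edge x (enumerate (neighbours x) i)
    edge i = ∈-comprehension⁻ (Edge? x) (enumerate-∈ (neighbours x) i)

  -- A part of at most two points holding two of a, b, c is an edge, hence neither ac nor bc but ab;
  -- its complement then holds only d from the triple abd.
  pair-not-separating : ¬ Edge a c → ¬ Edge b c → HasPart 𝒮 P → ∣ P ∣ ≤ 2 →
    TwoIn P (triple a b c) → ¬ TwoIn (∁ P) (triple a b d)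
  pair-not-separating {a} {c} {b} {P} {d} ¬ac ¬bc has ∣P∣≤2
    (p , q , p≢q , (p∈P , q∈P) , p∈Y , q∈Y) (p′ , q′ , p′≢q′ , (p′∈ , q′∈) , p′∈Y′ , q′∈Y′) =
    go (∈-triple⁻ a b c p∈Y) (∈-triple⁻ a b c q∈Y)
    where
    pq : Edge p q
    pq = p≢q , subst (HasPart 𝒮) (∣p∣≤2⇒pair p≢q p∈P q∈P ∣P∣≤2) has
    ab∉ : a ∈ P → ¬ b ∈ P
    ab∉ a∈P b∈P = p′≢q′ (trans (is-d p′∈ p′∈Y′) (sym (is-d q′∈ q′∈Y′)))
      where
      is-d : w ∈ ∁ P → w ∈ triple a b d → w ≡ d
      is-d w∈∁P w∈ = [ (λ { refl → ⊥-elim (x∈∁p⇒x∉p w∈∁P a∈P) })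
                     , [ (λ { refl → ⊥-elim (x∈∁p⇒x∉p w∈∁P b∈P) }) , id ]′ ]′ (∈-triple⁻ a b d w∈)
    go : p ≡ a ⊎ p ≡ b ⊎ p ≡ c → ¬ (q ≡ a ⊎ q ≡ b ⊎ q ≡ c)
    go (inj₁ refl)        (inj₁ refl)        = p≢q refl
    go (inj₁ refl)        (inj₂ (inj₁ refl)) = ab∉ p∈P q∈P
    go (inj₁ refl)        (inj₂ (inj₂ refl)) = ¬ac pq
    go (inj₂ (inj₁ refl)) (inj₁ refl)        = ab∉ q∈P p∈P
    go (inj₂ (inj₁ refl)) (inj₂ (inj₁ refl)) = p≢q refl
    go (inj₂ (inj₁ refl)) (inj₂ (inj₂ refl)) = ¬bc pq
    go (inj₂ (inj₂ refl)) (inj₁ refl)        = ¬ac (Edge-sym pq)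
    go (inj₂ (inj₂ refl)) (inj₂ (inj₁ refl)) = ¬bc (Edge-sym pq)
    go (inj₂ (inj₂ refl)) (inj₂ (inj₂ refl)) = p≢q refl

  non-neighbours-not-separated : Small 𝒮 → ¬ Edge a c → ¬ Edge b c → ¬ Edge a d → ¬ Edge b d →
    ¬ Separated 𝒮 (triple a b c) (triple a b d)
  non-neighbours-not-separated {a} {c} {b} {d} small ¬ac ¬bc ¬ad ¬bd (P , has@(i , P∣) , two , two′)
    with pair-isPartOf 𝒮 small i
  ... | u , v , uv∣ with isPartOf⇒≡∨≡∁ (split i) uv∣ P∣
  ...   | inj₁ refl = pair-not-separating ¬ac ¬bc has (∣pair∣≤2 u v) two two′
  -- Here the complement of P is the small part, so c and d exchange roles.
  ...   | inj₂ refl = pair-not-separating ¬ad ¬bd (HasPart-∁ 𝒮 has)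
    (subst (λ Q → ∣ Q ∣ ≤ 2) (sym (∁-involutive (pair u v))) (∣pair∣≤2 u v)) two′
    (subst (λ Q → TwoIn Q (triple a b c)) (sym (∁-involutive (∁ (pair u v)))) two)

  ⌊n/2⌋≤dim : 5 ≤ n → In𝕊₂ 𝒮 → ∀ {m} → IsDim 𝒮 m → ⌊ n /2⌋ ≤ m
  ⌊n/2⌋≤dim 5≤n (inj , small) {m} (_ , max) = ≮⇒≥ λ m<n/2 →
    case any? (λ a → any? (Edge? a)) of λ where
      (yes (a , b , ab)) → with-edge m<n/2 ab
      (no ∄edge)         → without-edge λ a b ab → ∄edge (a , b , ab)
    where
    3<n : 3 < n
    3<n = ≤-trans (n≤1+n 4) 5≤n

    degree≤m : ∀ a → ∣ neighbours a ∣ ≤ m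
    degree≤m a = max _ (IncompatibleFamily⇒Contains 𝒮 (star 3<n a) a)

    two-triples : a ≢ b → a ≢ c → b ≢ c → a ≢ d → b ≢ d → c ≢ d →
                  ¬ Edge a c → ¬ Edge b c → ¬ Edge a d → ¬ ¬ Edge b d
    two-triples {a} {b} {c} {d} a≢b a≢c b≢c a≢d b≢d c≢d ¬ac ¬bc ¬ad ¬bd =
      non-neighbours-not-separated small ¬ac ¬bc ¬ad ¬bd
        (InjectiveSystem⇒Separating 𝒮 inj (triple a b c) (triple a b d)
          (∣triple∣≡3 a≢b a≢c b≢c) (∣triple∣≡3 a≢b a≢d b≢d) abc≢abd)
      where
      abc≢abd : triple a b c ≢ triple a b d
      abc≢abd eq = [ a≢c ∘ sym , [ b≢c ∘ sym , c≢d ]′ ]′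
        (∈-triple⁻ a b d (subst (c ∈_) eq (∈-triple₃ a b c)))

    with-edge : m < ⌊ n /2⌋ → ¬ Edge a b
    with-edge {a} {b} m<n/2 ab = from-two (two-elements (∁ U) 2≤∣∁U∣)
      where
      open ≤-Reasoning
      U : Subset n
      U = neighbours a ∪ neighbours b
      2+∣U∣≤n : 2 + ∣ U ∣ ≤ n
      2+∣U∣≤n = begin
        2 + ∣ U ∣                                ≤⟨ +-monoʳ-≤ 2 (∣p∪q∣≤∣p∣+∣q∣ (neighbours a) _) ⟩
        2 + (∣ neighbours a ∣ + ∣ neighbours b ∣)  ≤⟨ +-monoʳ-≤ 2 (+-mono-≤ (degree≤m a) (degree≤m b)) ⟩
        2 + (m + m)                              ≡⟨ cong suc (sym (+-suc m m)) ⟩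
        suc m + suc m                            ≤⟨ +-mono-≤ m<n/2 (≤-trans m<n/2 (⌊n/2⌋≤⌈n/2⌉ n)) ⟩
        ⌊ n /2⌋ + ⌈ n /2⌉                        ≡⟨ ⌊n/2⌋+⌈n/2⌉≡n n ⟩
        n                                        ∎
      2≤∣∁U∣ : 2 ≤ ∣ ∁ U ∣
      2≤∣∁U∣ = ≤-trans (m+n≤o⇒m≤o∸n 2 2+∣U∣≤n) (≤-reflexive (sym (∣∁p∣≡n∸∣p∣ U)))
      not-a : c ∈ ∁ U → ¬ Edge a c
      not-a c∈ ac = x∈∁p⇒x∉p c∈ (x∈p∪q⁺ (inj₁ (∈-comprehension⁺ (Edge? a) ac)))
      not-b : c ∈ ∁ U → ¬ Edge b c
      not-b c∈ bc = x∈∁p⇒x∉p c∈ (x∈p∪q⁺ (inj₂ (∈-comprehension⁺ (Edge? b) bc)))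
      -- The points a and b are neighbours of each other and so lie in U; this makes c and d
      -- different from both.
      from-two : ¬ (∃₂ λ c d → c ≢ d × c ∈ ∁ U × d ∈ ∁ U)
      from-two (c , d , c≢d , c∈ , d∈) = two-triples (proj₁ ab)
        (λ { refl → not-b c∈ (Edge-sym ab) }) (λ { refl → not-a c∈ ab })
        (λ { refl → not-b d∈ (Edge-sym ab) }) (λ { refl → not-a d∈ ab }) c≢d
        (not-a c∈) (not-b c∈) (not-a d∈) (not-b d∈)

    -- With no edge at all, any four points can serve as a, b, c, d.
    without-edge : ¬ (∀ a b → ¬ Edge a b)
    without-edge none = two-triples (e≢ 0F 1F λ ()) (e≢ 0F 2F λ ()) (e≢ 1F 2F λ ())
        (e≢ 0F 3F λ ()) (e≢ 1F 3F λ ()) (e≢ 2F 3F λ ()) (none _ _) (none _ _) (none _ _) (none _ _)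
      where
      e≢ : ∀ (i j : Fin 4) → i ≢ j → inject≤ i 3<n ≢ inject≤ j 3<n
      e≢ i j i≢j = i≢j ∘ inject≤-injective _ _ i j

-- Upper bound

others : ∣ Y ∣ ≡ 3 → x ∈ Y → ∃₂ λ y z → (x ≢ y × x ≢ z × y ≢ z) × (y ∈ Y × z ∈ Y)
others {Y = Y} {x = x} ∣Y∣≡3 x∈Y with ∣p∣≡3⇒triple {p = Y} ∣Y∣≡3
... | a , b , c , (a≢b , a≢c , b≢c) , refl with ∈-triple⁻ a b c x∈Y
...   | inj₁ refl        = b , c , (a≢b , a≢c , b≢c) , (∈-triple₂ a b c , ∈-triple₃ a b c)
...   | inj₂ (inj₁ refl) = a , c , (a≢b ∘ sym , b≢c , a≢c) , (∈-triple₁ a b c , ∈-triple₃ a b c)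
...   | inj₂ (inj₂ refl) = a , b , (a≢c ∘ sym , b≢c ∘ sym , a≢b) , (∈-triple₁ a b c , ∈-triple₂ a b c)

∃∈∖ : ∀ (Y Y′ : Subset n) → ∣ Y′ ∣ ≤ ∣ Y ∣ → Y ≢ Y′ → ∃[ x ] x ∈ Y × x ∉ Y′
∃∈∖ Y Y′ ∣Y′∣≤∣Y∣ Y≢Y′ = decidable-stable (any? λ x → x ∈? Y ×-dec ¬? (x ∈? Y′))
  λ ∄x → Y≢Y′ (p⊆q∧∣q∣≤∣p∣⇒p≡q Y Y′
    (λ {x} x∈Y → decidable-stable (x ∈? Y′) λ x∉Y′ → ∄x (x , x∈Y , x∉Y′)) ∣Y′∣≤∣Y∣)

-- As x is not in Y, removing the pair costs Y at most the point y.
TwoIn-∁pair : ∣ Y ∣ ≡ 3 → x ∉ Y → ∀ y → TwoIn (∁ (pair x y)) Y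
TwoIn-∁pair {Y = Y} {x} ∣Y∣≡3 x∉Y y with three-elements Y (≤-reflexive (sym ∣Y∣≡3))
... | u , v , w , (u≢v , u≢w , v≢w) , (u∈ , v∈ , w∈) with u ≟ y | v ≟ y
...   | yes refl | _        = v , w , v≢w , (avoid v∈ (u≢v ∘ sym) , avoid w∈ (u≢w ∘ sym)) , (v∈ , w∈)
  where avoid = λ {z} (z∈Y : z ∈ Y) z≢y → ∉-pair {z = z} x y (λ { refl → x∉Y z∈Y }) z≢y
...   | no u≢y   | yes refl = u , w , u≢w , (avoid u∈ u≢y , avoid w∈ (v≢w ∘ sym)) , (u∈ , w∈)
  where avoid = λ {z} (z∈Y : z ∈ Y) z≢y → ∉-pair {z = z} x y (λ { refl → x∉Y z∈Y }) z≢y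
...   | no u≢y   | no v≢y   = u , v , u≢v , (avoid u∈ u≢y , avoid v∈ v≢y) , (u∈ , v∈)
  where avoid = λ {z} (z∈Y : z ∈ Y) z≢y → ∉-pair {z = z} x y (λ { refl → x∉Y z∈Y }) z≢y

-- The complement of a graph H without 3-cycles and 4-cycles

module _ (5≤n : 5 ≤ n) (H : Fin n → Fin n → Set) (H? : ∀ x y → Dec (H x y))
         (H-irrefl : ∀ {x} → ¬ H x x) (H-sym : ∀ {x y} → H x y → H y x)
         (no-3-cycle : ∀ {x y z} → H x y → H y z → ¬ H x z)
         (no-4-cycle : ∀ {x x′ y z} → x ≢ x′ → y ≢ z → H x y → H x z → H x′ y → ¬ H x′ z)
         (two-neighbours : ∀ x → ∃₂ λ s t → s ≢ t × H x s × H x t)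
         (triangle-bound : 3 ≤ n ∸ 3 ⊎ (∀ x y z → ¬ H x y → ¬ H x z → ¬ H y z → x ≡ y ⊎ x ≡ z ⊎ y ≡ z))
         where

  nonEdges : SplitSystem n
  nonEdges = pairSystem 5≤n (λ x y → ¬ H x y) (λ x y → ¬? (H? x y)) (λ _ → H-irrefl)

  nonEdges-small : Small nonEdges
  nonEdges-small = pairSystem-small 5≤n (λ x y → ¬ H x y) (λ x y → ¬? (H? x y)) (λ _ → H-irrefl)

  nonEdge-separates : x ≢ y → x ∈ Y → y ∈ Y → ¬ H x y → ∣ Y′ ∣ ≡ 3 → x ∉ Y′ → Separated nonEdges Y Y′
  nonEdge-separates {x} {y} x≢y x∈Y y∈Y ¬Hxy ∣Y′∣ x∉Y′ = pair x y
    , pairSystem-HasPart⁺ 5≤n _ (λ x y → ¬? (H? x y)) (λ _ → H-irrefl) x y ¬Hxy (inj₁ refl)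
    , (x , y , x≢y , (∈-pairˡ x y , ∈-pairʳ x y) , (x∈Y , y∈Y))
    , TwoIn-∁pair ∣Y′∣ x∉Y′ y

  -- Let x be in Y only, x′ in Y′ only, and Y = {x, y, z}. Without separation every pair in Y at a
  -- point outside Y′ is in H, and likewise with Y and Y′ exchanged. If y or z were outside Y′, then
  -- x, y, z would be a 3-cycle of H; so both are in Y′, and x, y, x′, z is a 4-cycle.
  nonEdges-Separating : Separating nonEdges
  nonEdges-Separating Y Y′ ∣Y∣ ∣Y′∣ Y≢Y′ = decidable-stable (Separated? nonEdges Y Y′) contra
    where
    contra : ¬ ¬ Separated nonEdges Y Y′
    contra ¬sep with ∃∈∖ Y Y′ (≤-reflexive (trans ∣Y′∣ (sym ∣Y∣))) Y≢Y′
                   | ∃∈∖ Y′ Y (≤-reflexive (trans ∣Y∣ (sym ∣Y′∣))) (Y≢Y′ ∘ sym)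
    ... | x , x∈Y , x∉Y′ | x′ , x′∈Y′ , x′∉Y with others ∣Y∣ x∈Y
    ...   | y , z , (x≢y , x≢z , y≢z) , (y∈Y , z∈Y) =
      no-4-cycle (λ { refl → x′∉Y x∈Y }) y≢z Hxy Hxz (H′ y∈Y y∈Y′) (H′ z∈Y z∈Y′)
      where
      H⁺ : ∀ {x y} → x ≢ y → x ∈ Y → y ∈ Y → x ∉ Y′ → H x y
      H⁺ {x} {y} x≢y x∈Y y∈Y x∉Y′ = decidable-stable (H? x y) λ ¬Hxy →
        ¬sep (nonEdge-separates x≢y x∈Y y∈Y ¬Hxy ∣Y′∣ x∉Y′)
      H′ : ∀ {y} → y ∈ Y → y ∈ Y′ → H x′ y
      H′ {y} y∈Y y∈Y′ = decidable-stable (H? x′ y) λ ¬Hx′y → ¬sep (Separated-sym nonEdges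
        (nonEdge-separates (λ { refl → x′∉Y y∈Y }) x′∈Y′ y∈Y′ ¬Hx′y ∣Y∣ x′∉Y))
      Hxy = H⁺ x≢y x∈Y y∈Y x∉Y′
      Hxz = H⁺ x≢z x∈Y z∈Y x∉Y′
      y∈Y′ : y ∈ Y′
      y∈Y′ = decidable-stable (y ∈? Y′) λ y∉Y′ → no-3-cycle Hxy (H⁺ y≢z y∈Y z∈Y y∉Y′) Hxz
      z∈Y′ : z ∈ Y′
      z∈Y′ = decidable-stable (z ∈? Y′) λ z∉Y′ → no-3-cycle Hxz (H⁺ (y≢z ∘ sym) z∈Y y∈Y z∉Y′) Hxy

  NonEdge : Subset n → Set
  NonEdge P = ∃₂ λ x y → ¬ H x y × P ≡ pair x y

  orient : NonEdge P → x ∈ P → ∃[ y ] ¬ H x y × P ≡ pair x y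
  orient (a , b , ¬Hab , refl) x∈ with ∈-pair⁻ a b x∈
  ... | inj₁ refl = b , ¬Hab , refl
  ... | inj₂ refl = a , ¬Hab ∘ H-sym , ∪-comm ⁅ a ⁆ ⁅ b ⁆

  module _ {k} (U : Fin k → Subset n) (U-nonEdge : ∀ i → NonEdge (U i))
           (U-meet : ∀ i j → i ≢ j → Nonempty (U i ∩ U j))
           (U-diff : ∀ i j → i ≢ j → Nonempty (U i ∩ ∁ (U j))) where

    U-injective : ∀ {i j} → U i ≡ U j → i ≡ j
    U-injective {i} {j} Ui≡Uj = decidable-stable (i ≟ j) λ i≢j →
      let x , x∈ = U-diff i j i≢j ; x∈Ui , x∈∁Uj = x∈p∩q⁻ (U i) _ x∈
      in x∈∁p⇒x∉p x∈∁Uj (subst (x ∈_) Ui≡Uj x∈Ui)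

    -- The point of `U i` outside `U j` is not x, so it is the second point of `U i`. This also
    -- excludes the singletons `pair x x`, which count as `NonEdge`.
    other-end : ∀ {i j} → i ≢ j → x ∈ U i → x ∈ U j →
                ∃[ y ] ¬ H x y × U i ≡ pair x y × y ∉ U j
    other-end {x} {i} {j} i≢j x∈Ui x∈Uj with orient (U-nonEdge i) x∈Ui | U-diff i j i≢j
    ... | y , ¬Hxy , Ui≡xy | w , w∈ = y , ¬Hxy , Ui≡xy , y∉Uj
      where
      w∈Ui = proj₁ (x∈p∩q⁻ (U i) _ w∈)
      w∉Uj = x∈∁p⇒x∉p (proj₂ (x∈p∩q⁻ (U i) _ w∈))
      y∉Uj : y ∉ U j
      y∉Uj = [ (λ { refl → ⊥-elim (w∉Uj x∈Uj) }) , (λ { refl → w∉Uj }) ]′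
        (∈-pair⁻ x y (subst (w ∈_) Ui≡xy w∈Ui))

    -- The second ends of the edges at x are distinct and avoid x and its H-neighbours s and t.
    star-bound : ∀ x → (∀ i → x ∈ U i) → ∀ (i j : Fin k) → i ≢ j → k ≤ n ∸ 3
    star-bound x x∈U i₀ j₀ i₀≢j₀ with two-neighbours x
    ... | s , t , s≢t , Hxs , Hxt =
      ≤-trans (injective⇒≤∣p∣ {p = ⊤ - x - s - t} (λ i → proj₁ (end i)) end-injective end∈)
        (m+n≤o⇒m≤o∸n _ (≤-trans (≤-reflexive (+-comm _ 3)) size≤))
      where
      -- Every index gets a different one to compare with, as `other-end` demands.
      other : ∀ i → ∃[ j ] i ≢ j
      other i with i ≟ i₀
      ... | yes refl = j₀ , i₀≢j₀
      ... | no i≢i₀  = i₀ , i≢i₀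
      end : ∀ i → ∃[ y ] ¬ H x y × U i ≡ pair x y × y ∉ U (proj₁ (other i))
      end i = other-end (proj₂ (other i)) (x∈U i) (x∈U _)
      end-injective : Injective _≡_ _≡_ (λ i → proj₁ (end i))
      end-injective {i} {j} eq = U-injective (trans (proj₁ (proj₂ (proj₂ (end i))))
        (trans (cong (pair x) eq) (sym (proj₁ (proj₂ (proj₂ (end j)))))))
      end∈ : ∀ i → proj₁ (end i) ∈ ⊤ - x - s - t
      end∈ i = let y , ¬Hxy , _ , y∉ = end i in x∈p∧x≢y⇒x∈p-y (x∈p∧x≢y⇒x∈p-y (x∈p∧x≢y⇒x∈p-y ∈⊤
        (λ eq → y∉ (subst (_∈ U (proj₁ (other i))) (sym eq) (x∈U _))))
        (λ eq → ¬Hxy (subst (H x) (sym eq) Hxs))) (λ eq → ¬Hxy (subst (H x) (sym eq) Hxt))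
      s∈ : s ∈ ⊤ - x
      s∈ = x∈p∧x≢y⇒x∈p-y ∈⊤ λ { refl → H-irrefl Hxs }
      t∈ : t ∈ ⊤ - x - s
      t∈ = x∈p∧x≢y⇒x∈p-y (x∈p∧x≢y⇒x∈p-y ∈⊤ λ { refl → H-irrefl Hxt }) (s≢t ∘ sym)
      size≤ : 3 + ∣ ⊤ - x - s - t ∣ ≤ n
      size≤ = begin
        3 + ∣ ⊤ - x - s - t ∣  ≤⟨ +-monoʳ-≤ 2 (x∈p⇒∣p-x∣<∣p∣ t∈) ⟩
        2 + ∣ ⊤ - x - s ∣      ≤⟨ +-monoʳ-≤ 1 (x∈p⇒∣p-x∣<∣p∣ s∈) ⟩
        1 + ∣ ⊤ - x ∣          ≤⟨ x∈p⇒∣p-x∣<∣p∣ {x = x} ∈⊤ ⟩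
        ∣ ⊤ {n} ∣              ≡⟨ ∣⊤∣≡n n ⟩
        n                      ∎
        where open ≤-Reasoning

    -- Pairwise intersecting edges form a star or a triangle.
    intersecting-bound : ∀ (i j : Fin k) → i ≢ j → k ≤ n ∸ 3
    intersecting-bound i j i≢j with U-meet i j i≢j
    ... | a , a∈ with x∈p∩q⁻ (U i) (U j) a∈
    ...   | a∈Ui , a∈Uj with all? (λ l → a ∈? U l)
    ...     | yes a∈U = star-bound a a∈U i j i≢j
    ...     | no ¬a∈U with ¬∀⟶∃¬ k _ (λ l → a ∈? U l) ¬a∈U
                        | other-end i≢j a∈Ui a∈Uj | other-end (i≢j ∘ sym) a∈Uj a∈Ui
    ...       | m , a∉Um | b , ¬Hab , Ui≡ab , b∉Uj | c , ¬Hac , Uj≡ac , c∉Ui = bound triangle-bound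
      where
      b≢c : b ≢ c
      b≢c refl = b∉Uj (subst (c ∈_) (sym Uj≡ac) (∈-pairʳ a c))

      -- Applied to ab and ac, this forces an edge that misses a to be bc.
      meets-pair : ∀ l l′ → a ∉ U l → ∀ {w} → U l′ ≡ pair a w → w ∈ U l
      meets-pair l l′ a∉Ul {w} eq
        with U-meet l l′ (λ { refl → a∉Ul (subst (a ∈_) (sym eq) (∈-pairˡ a w)) })
      ... | v , v∈ with x∈p∩q⁻ (U l) (U l′) v∈
      ...   | v∈Ul , v∈Ul′ with ∈-pair⁻ a w (subst (v ∈_) eq v∈Ul′)
      ...     | inj₁ refl = ⊥-elim (a∉Ul v∈Ul)
      ...     | inj₂ refl = v∈Ul

      opposite-edge : ∀ l → a ∉ U l → ¬ H b c × U l ≡ pair b c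
      opposite-edge l a∉Ul with orient (U-nonEdge l) (meets-pair l i a∉Ul Ui≡ab)
      ... | o , ¬Hbo , eq with ∈-pair⁻ b o (subst (c ∈_) eq (meets-pair l j a∉Ul Uj≡ac))
      ...   | inj₁ refl = ⊥-elim (b≢c refl)
      ...   | inj₂ refl = ¬Hbo , eq

      ¬Hbc = proj₁ (opposite-edge m a∉Um)
      Um≡bc = proj₂ (opposite-edge m a∉Um)

      -- An edge that misses a is bc; an edge at a must meet bc and is therefore ab or ac.
      all-edges : ∀ l → l ∈ triple i j m
      all-edges l with a ∈? U l
      ... | no a∉Ul = subst (_∈ triple i j m)
              (U-injective (trans Um≡bc (sym (proj₂ (opposite-edge l a∉Ul))))) (∈-triple₃ i j m)
      ... | yes a∈Ul with orient (U-nonEdge l) a∈Ul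
      ...   | o , _ , Ul≡ao with ∈-pair⁻ b c (subst (o ∈_) Um≡bc (meets-pair m l a∉Um Ul≡ao))
      ...     | inj₁ refl = subst (_∈ triple i j m) (U-injective (trans Ui≡ab (sym Ul≡ao))) (∈-triple₁ i j m)
      ...     | inj₂ refl = subst (_∈ triple i j m) (U-injective (trans Uj≡ac (sym Ul≡ao))) (∈-triple₂ i j m)

      bound : _ → k ≤ n ∸ 3
      bound (inj₁ 3≤n∸3) = begin
        k                   ≡⟨ ∣⊤∣≡n k ⟨
        ∣ ⊤ {k} ∣           ≤⟨ p⊆q⇒∣p∣≤∣q∣ {p = ⊤} (λ {l} _ → all-edges l) ⟩
        ∣ triple i j m ∣    ≤⟨ ∣triple∣≤3 i j m ⟩
        3                   ≤⟨ 3≤n∸3 ⟩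
        n ∸ 3               ∎
        where open ≤-Reasoning
      bound (inj₂ no-triangle) = ⊥-elim
        ([ (λ { refl → b∉Uj a∈Uj }) , [ (λ { refl → c∉Ui a∈Ui }) , b≢c ]′ ]′
          (no-triangle a b c ¬Hab ¬Hac ¬Hbc))

  nonEdges-dim≤ : IncompatibleFamily nonEdges k → k ≤ n ∸ 3
  nonEdges-dim≤ {zero}        _ = z≤n
  -- A single split is within the bound since n ∸ 3 is at least 2; larger families have the two
  -- indices needed to start `intersecting-bound`.
  nonEdges-dim≤ {suc zero}    _ = ≤-trans (n≤1+n 1) (∸-monoˡ-≤ 3 5≤n)
  nonEdges-dim≤ {suc (suc k)} (f , inc) = intersecting-bound (λ i → proj₁ (chosen i))
      (λ i → proj₁ (proj₂ (chosen i)))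
      (λ i j i≢j → inc i j i≢j _ _ (isPart i) (isPart j))
      (λ i j i≢j → inc i j i≢j _ _ (isPart i) (∁-isPartOf {S = split (f j)} (isPart j)))
      zero (suc zero) λ ()
    where
    open SplitSystem nonEdges
    chosen : ∀ i → ∃[ P ] NonEdge P × P isPartOf split (f i)
    chosen i with pairSystem-HasPart⁻ 5≤n _ (λ x y → ¬? (H? x y)) (λ _ → H-irrefl) (f i , inj₁ refl)
    ... | x , y , ¬Hxy , A∣ = pair x y , (x , y , ¬Hxy , refl)
        , common-part⇒≈ˢ (pairSplit 5≤n x y) (split (f i)) A∣ (inj₁ refl)
    isPart : ∀ i → proj₁ (chosen i) isPartOf split (f i)
    isPart i = proj₂ (proj₂ (chosen i))

  injectiveDim≤n∸3 : ∃[ d ] InjectiveDim 5≤n d × d ≤ n ∸ 3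
  injectiveDim≤n∸3 =
    let d , dim@(cube , _) = IsDim-exists nonEdges (fromℕ< (≤-trans (s≤s z≤n) 5≤n))
    in d , (nonEdges , (Separating⇒InjectiveSystem nonEdges nonEdges-Separating , nonEdges-small) , dim)
         , nonEdges-dim≤ (Contains⇒IncompatibleFamily nonEdges cube)

-- The cycle on n points

module Cycle (m : ℕ) where
  private
    N = 5 + m

  rotate : ℕ → Fin N → Fin N
  rotate k x = fromℕ< (m%n<n (k + toℕ x) N)

  toℕ-rotate : ∀ k x → toℕ (rotate k x) ≡ (k + toℕ x) % N
  toℕ-rotate k x = toℕ-fromℕ< (m%n<n (k + toℕ x) N)

  rotate-rotate : ∀ k l x → rotate k (rotate l x) ≡ rotate (k + l) x
  rotate-rotate k l x = toℕ-injective (begin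
    toℕ (rotate k (rotate l x))               ≡⟨ toℕ-rotate k (rotate l x) ⟩
    (k + toℕ (rotate l x)) % N                ≡⟨ cong (λ i → (k + i) % N) (toℕ-rotate l x) ⟩
    (k + (l + toℕ x) % N) % N                 ≡⟨ %-distribˡ-+ k ((l + toℕ x) % N) N ⟩
    (k % N + (l + toℕ x) % N % N) % N         ≡⟨ cong (λ i → (k % N + i) % N) (m%n%n≡m%n (l + toℕ x) N) ⟩
    (k % N + (l + toℕ x) % N) % N             ≡⟨ %-distribˡ-+ k (l + toℕ x) N ⟨
    (k + (l + toℕ x)) % N                     ≡⟨ cong (_% N) (+-assoc k l (toℕ x)) ⟨
    (k + l + toℕ x) % N                       ≡⟨ toℕ-rotate (k + l) x ⟨
    toℕ (rotate (k + l) x)                    ∎)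
    where open ≡-Reasoning

  rotate-n : ∀ x → rotate N x ≡ x
  rotate-n x = toℕ-injective (begin
    toℕ (rotate N x)   ≡⟨ toℕ-rotate N x ⟩
    (N + toℕ x) % N    ≡⟨ cong (_% N) (+-comm N (toℕ x)) ⟩
    (toℕ x + N) % N    ≡⟨ [m+n]%n≡m%n (toℕ x) N ⟩
    toℕ x % N          ≡⟨ m<n⇒m%n≡m (toℕ<n x) ⟩
    toℕ x              ∎)
    where open ≡-Reasoning

  -- k is recovered from rotate k x as its offset from x.
  rotate-injective : ∀ {k l} x → k < N → l < N → rotate k x ≡ rotate l x → k ≡ l
  rotate-injective {k} {l} x k<n l<n eq = trans (sym (offset k k<n))
    (trans (cong (λ y → (toℕ y + (N ∸ toℕ x)) % N) eq) (offset l l<n))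
    where
    open ≡-Reasoning
    offset : ∀ k → k < N → (toℕ (rotate k x) + (N ∸ toℕ x)) % N ≡ k
    offset k k<n = begin
      (toℕ (rotate k x) + r) % N              ≡⟨ cong (λ i → (i + r) % N) (toℕ-rotate k x) ⟩
      ((k + toℕ x) % N + r) % N               ≡⟨ %-distribˡ-+ ((k + toℕ x) % N) r N ⟩
      ((k + toℕ x) % N % N + r % N) % N       ≡⟨ cong (λ i → (i + r % N) % N) (m%n%n≡m%n (k + toℕ x) N) ⟩
      ((k + toℕ x) % N + r % N) % N           ≡⟨ %-distribˡ-+ (k + toℕ x) r N ⟨
      (k + toℕ x + r) % N                     ≡⟨ cong (_% N) (+-assoc k (toℕ x) r) ⟩
      (k + (toℕ x + r)) % N                   ≡⟨ cong (λ i → (k + i) % N) (m+[n∸m]≡n (<⇒≤ (toℕ<n x))) ⟩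
      (k + N) % N                             ≡⟨ [m+n]%n≡m%n k N ⟩
      k % N                                   ≡⟨ m<n⇒m%n≡m k<n ⟩
      k                                       ∎
      where r = N ∸ toℕ x

  next : Fin N → Fin N
  next = rotate 1

  -- One step back is N ∸ 1 = 4 + m steps forward.
  previous : Fin N → Fin N
  previous = rotate (4 + m)

  next-previous : ∀ x → next (previous x) ≡ x
  next-previous x = trans (rotate-rotate 1 (4 + m) x) (rotate-n x)

  next-injective : ∀ {x y} → next x ≡ next y → x ≡ y
  next-injective {x} {y} eq = trans (sym (previous-next x)) (trans (cong previous eq) (previous-next y))
    where
    previous-next : ∀ x → previous (next x) ≡ x
    previous-next x = trans (rotate-rotate (4 + m) 1 x)
      (trans (cong (λ k → rotate k x) (+-comm (4 + m) 1)) (rotate-n x))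

  rotate≢ : ∀ k x → suc k < N → x ≢ rotate (suc k) x
  rotate≢ k x k<n eq = case rotate-injective x (s≤s z≤n) k<n (trans (rotate-0 x) eq) of λ ()
    where
    rotate-0 : ∀ x → rotate 0 x ≡ x
    rotate-0 x = toℕ-injective (trans (toℕ-rotate 0 x) (m<n⇒m%n≡m (toℕ<n x)))

  next²≡ : ∀ x → next (next x) ≡ rotate 2 x
  next²≡ = rotate-rotate 1 1

  next³≡ : ∀ x → next (next (next x)) ≡ rotate 3 x
  next³≡ x = trans (cong next (next²≡ x)) (rotate-rotate 1 2 x)

  next≢ : ∀ {x} → x ≢ next x
  next≢ {x} = rotate≢ 0 x (s≤s (s≤s z≤n))

  next³≢ : ∀ {x} → x ≢ next (next (next x))
  next³≢ {x} eq = rotate≢ 2 x (s≤s (s≤s (s≤s (s≤s z≤n)))) (trans eq (next³≡ x))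

  -- This rests on 4 < N, so it is here that N must be at least 5.
  next⁴≢ : ∀ {x} → x ≢ next (next (next (next x)))
  next⁴≢ {x} eq = rotate≢ 3 x (s≤s (s≤s (s≤s (s≤s (s≤s z≤n)))))
    (trans eq (trans (cong next (next³≡ x)) (rotate-rotate 1 3 x)))

  Adjacent : Fin N → Fin N → Set
  Adjacent x y = y ≡ next x ⊎ x ≡ next y

  Adjacent? : ∀ x y → Dec (Adjacent x y)
  Adjacent? x y = (y ≟ next x) ⊎-dec (x ≟ next y)

  irrefl : ∀ {x} → ¬ Adjacent x x
  irrefl = [ next≢ , next≢ ]′

  -- Three steps in one direction would close up, against `next³≢`; if the directions differ, two
  -- steps cancel and a point would be adjacent to itself.
  no-3-cycle : ∀ {x y z} → Adjacent x y → Adjacent y z → ¬ Adjacent x z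
  no-3-cycle (inj₁ refl) (inj₁ refl) (inj₁ eq)   = next≢ (sym eq)
  no-3-cycle (inj₁ refl) (inj₁ refl) (inj₂ eq)   = next³≢ eq
  no-3-cycle (inj₁ refl) (inj₂ eq)   xz          = irrefl (subst (Adjacent _) (sym (next-injective eq)) xz)
  no-3-cycle (inj₂ refl) (inj₁ refl) xz          = irrefl xz
  no-3-cycle (inj₂ refl) (inj₂ refl) (inj₁ eq)   = next³≢ eq
  no-3-cycle (inj₂ refl) (inj₂ refl) (inj₂ eq)   = next≢ (sym eq)

  -- On the walk x, y, x′, z, x either two consecutive steps cancel, identifying x with x′ or y with
  -- z, or all steps go the same way, against `next⁴≢`.
  no-4-cycle : ∀ {x x′ y z} → x ≢ x′ → y ≢ z →
               Adjacent x y → Adjacent x z → Adjacent x′ y → ¬ Adjacent x′ z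
  no-4-cycle x≢x′ y≢z (inj₁ refl) (inj₁ refl) _           _           = y≢z refl
  no-4-cycle x≢x′ y≢z (inj₁ refl) (inj₂ refl) (inj₁ eq)   _           = x≢x′ (next-injective eq)
  no-4-cycle x≢x′ y≢z (inj₁ refl) (inj₂ refl) (inj₂ refl) (inj₁ eq)   = next⁴≢ eq
  no-4-cycle x≢x′ y≢z (inj₁ refl) (inj₂ refl) (inj₂ refl) (inj₂ eq)   = x≢x′ (sym eq)
  no-4-cycle x≢x′ y≢z (inj₂ refl) (inj₂ eq)   _           _           = y≢z (next-injective eq)
  no-4-cycle x≢x′ y≢z (inj₂ refl) (inj₁ refl) (inj₂ refl) _           = x≢x′ refl
  no-4-cycle x≢x′ y≢z (inj₂ refl) (inj₁ refl) (inj₁ refl) (inj₁ eq)   = y≢z (sym eq)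
  no-4-cycle x≢x′ y≢z (inj₂ refl) (inj₁ refl) (inj₁ refl) (inj₂ eq)   = next⁴≢ eq

  two-neighbours : ∀ x → ∃₂ λ s t → s ≢ t × Adjacent x s × Adjacent x t
  two-neighbours x = next x , previous x
    , (λ eq → case rotate-injective x (s≤s (s≤s z≤n)) ≤-refl eq of λ ())
    , inj₁ refl , inj₂ (sym (next-previous x))

-- Checked over all triples. The complement of a 5-cycle is again a 5-cycle and so has no triangle.
5-cycle-independent : ∀ x y z → let open Cycle 0 in
  ¬ Adjacent x y → ¬ Adjacent x z → ¬ Adjacent y z → x ≡ y ⊎ x ≡ z ⊎ y ≡ z
5-cycle-independent x y z ¬xy ¬xz ¬yz = [ ⊥-elim ∘ ¬xy , [ ⊥-elim ∘ ¬xz , [ ⊥-elim ∘ ¬yz , id ]′ ]′ ]′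
  (from-yes (all? λ x → all? λ y → all? λ z → Adjacent? x y ⊎-dec Adjacent? x z ⊎-dec
    Adjacent? y z ⊎-dec (x ≟ y) ⊎-dec (x ≟ z) ⊎-dec (y ≟ z)) x y z)
  where open Cycle 0

cycle-triangle-bound : ∀ m → 3 ≤ (5 + m) ∸ 3 ⊎ (∀ x y z → let open Cycle m in
  ¬ Adjacent x y → ¬ Adjacent x z → ¬ Adjacent y z → x ≡ y ⊎ x ≡ z ⊎ y ≡ z)
cycle-triangle-bound zero    = inj₂ 5-cycle-independent
cycle-triangle-bound (suc m) = inj₁ (s≤s (s≤s (s≤s z≤n)))

theorem4 : ∀ (n : ℕ) → 5 ≤ n →
    ∃[ m ] (IsID₂ n m × ⌊ n /2⌋ ≤ m × m ≤ n ∸ 3)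
theorem4 n 5≤n@(s≤s (s≤s (s≤s (s≤s (s≤s {n = m} z≤n))))) =
  -- The dimension d obtained from the cycle both starts the search for the minimum and bounds it.
  let open Cycle m
      d , injectiveDim-d , d≤n∸3 = injectiveDim≤n∸3 5≤n Adjacent Adjacent? irrefl Sum.swap
        no-3-cycle no-4-cycle two-neighbours (cycle-triangle-bound m)
      e , min@((𝒮 , in𝕊₂ , dim) , least) = IsMin-exists (InjectiveDim? 5≤n) d injectiveDim-d
  in e , min , ⌊n/2⌋≤dim 𝒮 5≤n in𝕊₂ dim , ≤-trans (least d injectiveDim-d) d≤n∸3
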